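{- For every integer $k\ge1$, $$E^{(k-1)(k-2)\cdots1k}_{1\text{ - }23}(x)=\begin{cases}e^{e^x}\displaystyle\int_0^x\int_0^t\frac{r^{k-2}}{(k-2)!}\,e^{r-e^t}\,dr\,dt,&\text{if }k\ge2,\\[2mm] e^{e^x-1},&\text{if }k=1.\end{cases}$$
   Context: A permutation $\pi=\pi_1\cdots\pi_n$ of $\{1,\dots,n\}$ contains the generalized pattern $1\text{ - }23$ if there are indices $i<j<n$ such that $\pi_i\pi_j\pi_{j+1}$ is order-isomorphic to $123$; otherwise it avoids it. A permutation $\pi$ begins with a pattern $p=p_1\cdots p_k$ if $n\ge k$ and $\pi_1\cdots\pi_k$ is order-isomorphic to $p$; by convention, the empty permutation is also regarded as beginning with the pattern $1$ (the case $k=1$). The pattern $(k-1)(k-2)\cdots1k$ consists of $k-1,k-2,\dots,1$ in decreasing order followed by $k$ (for $k=1$ it is $1$, for $k=2$ it is $12$). $E^p_q(x)=\sum_{n\ge0}N^p_q(n)\frac{x^n}{n!}$, where $N^p_q(n)$ is the number of permutations of $\{1,\dots,n\}$ that avoid $q$ and begin with $p$. Identities are identities of power series in $x$. -}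

module Defs where

open import Algebra.Bundles using (CommutativeRing)
open import Algebra.Bundles.Raw using (RawRing)
import Algebra.Definitions.RawMonoid as RawMonoidDefinitions
import Algebra.Definitions.RawSemiring as RawSemiringDefinitions
open import Algebra.Morphism.Structures using (IsMonoidHomomorphism; IsRingHomomorphism)
open import Data.Fin.Base as Fin using (Fin; toℕ; fromℕ; inject₁)
import Data.Fin.Properties as Fin
open import Data.Integer.Base using (+_)
open import Data.List.Base using (List; []; _∷_; cartesianProductWith; allFin; filter; length)
open import Data.Nat.Base using (ℕ; zero; suc; NonZero; _∸_; _≤_; _!)
import Data.Nat.Properties as ℕ
open import Data.Product.Base using (Σ; ∃-syntax; _×_; _,_; proj₁; proj₂)
open import Data.Rational.Base as ℚ using (ℚ)
open import Data.Sum.Base using (_⊎_)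
open import Data.Vec.Base as Vec using (Vec; []; _∷_; lookup; truncate; _∷ʳ_)
import Data.Vec.Relation.Unary.AllPairs as AllPairs
open import Data.Vec.Relation.Unary.Unique.Propositional using (Unique)
open import Function.Bundles using (_⇔_; mk⇔; module Equivalence)
open import Level using (Level) renaming (suc to lsuc; _⊔_ to _⊔ˡ_)
open import Relation.Binary.PropositionalEquality using (_≡_; subst)
open import Relation.Nullary.Decidable using (Dec; yes; no; ¬?; map′; _×-dec_; _⊎-dec_; _→-dec_)
open import Relation.Nullary.Negation using (¬_)

private
  variable
    k l m n : ℕ
    c ℓ : Level

-- Permutations of {1,…,n} are words π₁⋯πₙ without repetition over Fin n, so
-- both positions and letters are shifted down by one.

OrderIsomorphic : Vec (Fin m) k → Vec (Fin l) k → Set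
OrderIsomorphic u v =
  ∀ i j → (lookup u i Fin.< lookup u j) ⇔ (lookup v i Fin.< lookup v j)

Contains-1-23 : Vec (Fin n) n → Set
Contains-1-23 {n} π =
  ∃[ i ] ∃[ j ] ∃[ j⁺ ] (i Fin.< j × toℕ j⁺ ≡ suc (toℕ j) ×
    OrderIsomorphic (lookup π i ∷ lookup π j ∷ lookup π j⁺ ∷ []) (Vec.allFin 3))

Avoids-1-23 : Vec (Fin n) n → Set
Avoids-1-23 π = ¬ Contains-1-23 π

-- The second alternative is the convention that the empty permutation begins
-- with the pattern 1.
BeginsWith : Vec (Fin k) k → Vec (Fin n) n → Set
BeginsWith {k} {n} p π =
  (Σ (k ≤ n) λ k≤n → OrderIsomorphic (truncate k≤n π) p) ⊎ (k ≡ 1 × n ≡ 0)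

-- The pattern (k-1)(k-2)⋯1k.
startPattern : ∀ k → .{{NonZero k}} → Vec (Fin k) k
startPattern (suc m) = Vec.map inject₁ (Vec.reverse (Vec.allFin m)) ∷ʳ fromℕ m

orderIsomorphic? : (u : Vec (Fin m) k) (v : Vec (Fin l) k) → Dec (OrderIsomorphic u v)
orderIsomorphic? u v = Fin.all? λ i → Fin.all? λ j →
  let a = lookup u i Fin.<? lookup u j
      b = lookup v i Fin.<? lookup v j
  in map′ (λ fg → mk⇔ (proj₁ fg) (proj₂ fg))
          (λ e → Equivalence.to e , Equivalence.from e)
          ((a →-dec b) ×-dec (b →-dec a))

unique? : (π : Vec (Fin m) k) → Dec (Unique π)
unique? = AllPairs.allPairs? λ a b → ¬? (a Fin.≟ b)

avoids-1-23? : (π : Vec (Fin n) n) → Dec (Avoids-1-23 π)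
avoids-1-23? π = ¬? (Fin.any? λ i → Fin.any? λ j → Fin.any? λ j⁺ →
  (i Fin.<? j) ×-dec (toℕ j⁺ ℕ.≟ suc (toℕ j)) ×-dec
  orderIsomorphic? (lookup π i ∷ lookup π j ∷ lookup π j⁺ ∷ []) (Vec.allFin 3))

beginsWith? : (p : Vec (Fin k) k) (π : Vec (Fin n) n) → Dec (BeginsWith p π)
beginsWith? {k} {n} p π = prefix? ⊎-dec ((k ℕ.≟ 1) ×-dec (n ℕ.≟ 0))
  where
  prefix? : Dec (Σ (k ≤ n) λ k≤n → OrderIsomorphic (truncate k≤n π) p)
  prefix? with k ℕ.≤? n
  ... | no  k≰n = no λ (k≤n , _) → k≰n k≤n
  ... | yes k≤n = map′ (k≤n ,_)
    (λ (k≤n′ , iso) → subst (λ h → OrderIsomorphic (truncate h π) p) (ℕ.≤-irrelevant k≤n′ k≤n) iso)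
    (orderIsomorphic? (truncate k≤n π) p)

words : ∀ m n → List (Vec (Fin m) n)
words m zero    = [] ∷ []
words m (suc n) = cartesianProductWith _∷_ (allFin m) (words m n)

N-1-23 : Vec (Fin k) k → ℕ → ℕ
N-1-23 p n = length (filter
  (λ π → unique? π ×-dec avoids-1-23? π ×-dec beginsWith? p π) (words n n))

-- Series such as e^(e^x) have coefficients involving the constant e.
-- Coefficients are therefore taken in a commutative ℚ-algebra with an
-- exponential, i.e. a homomorphism from its additive to its multiplicative
-- monoid; the motivating example is ℝ with its usual exponential function.

record RawExpAlgebra c ℓ : Set (lsuc (c ⊔ˡ ℓ)) where
  field
    rawRing : RawRing c ℓ
  open RawRing rawRing public
  open RawSemiringDefinitions rawSemiring public using (_^_)
  open RawMonoidDefinitions +-rawMonoid public using (sum)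
  field
    fromℚ : ℚ → Carrier
    exp   : Carrier → Carrier

  infixl 6 _-_
  _-_ : Carrier → Carrier → Carrier
  x - y = x + (- y)

record ExpAlgebra c ℓ : Set (lsuc (c ⊔ˡ ℓ)) where
  field
    commutativeRing : CommutativeRing c ℓ
  open CommutativeRing commutativeRing
    using (Carrier; rawRing; +-rawMonoid; *-rawMonoid)
  field
    fromℚ                    : ℚ → Carrier
    fromℚ-isRingHomomorphism : IsRingHomomorphism ℚ.+-*-rawRing rawRing fromℚ
    exp                      : Carrier → Carrier
    exp-isMonoidHomomorphism : IsMonoidHomomorphism +-rawMonoid *-rawMonoid exp

  rawExpAlgebra : RawExpAlgebra c ℓ
  rawExpAlgebra = record { rawRing = rawRing ; fromℚ = fromℚ ; exp = exp }

1/_! : ℕ → ℚ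
1/ n ! = ((+ 1) ℚ./ (n !)) {{n ℕ.!≢0}}

module _ (K : RawExpAlgebra c ℓ) where
  private module K = RawExpAlgebra K

  Series : Set c
  Series = ℕ → K.Carrier

  const : K.Carrier → Series
  const a zero    = a
  const a (suc n) = K.0#

  var : Series
  var 1 = K.1#
  var _ = K.0#

  ∫₀ : Series → Series
  ∫₀ f zero    = K.0#
  ∫₀ f (suc n) = K.fromℚ ((+ 1) ℚ./ suc n) K.* f n

  egf : (ℕ → ℕ) → Series
  egf a n = K.fromℚ (((+ a n) ℚ./ (n !)) {{n ℕ.!≢0}})

  seriesRawRing : RawRing c ℓ
  seriesRawRing = record
    { Carrier = Series
    ; _≈_     = λ f g → ∀ n → f n K.≈ g n
    ; _+_     = λ f g n → f n K.+ g n
    ; _*_     = λ f g n → K.sum {suc n} λ i → f (toℕ i) K.* g (n ∸ toℕ i)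
    ; -_      = λ f n → K.- (f n)
    ; 0#      = const K.0#
    ; 1#      = const K.1#
    }

  private
    module R = RawRing seriesRawRing
    open RawSemiringDefinitions R.rawSemiring using (_^_)

  dropConst : Series → Series
  dropConst f zero    = K.0#
  dropConst f (suc n) = f (suc n)

  -- exp f = exp f₀ · Σₘ (f - f₀)ᵐ / m!.  As f - f₀ has no constant term, only
  -- the summands with m ≤ n contribute to the coefficient of index n.
  expSeries : Series → Series
  expSeries f n = K.exp (f 0) K.*
    K.sum {suc n} λ m → K.fromℚ (1/ toℕ m !) K.* (dropConst f ^ toℕ m) n

  powerSeries : RawExpAlgebra c ℓ
  powerSeries = record
    { rawRing = seriesRawRing
    ; fromℚ   = λ q → const (K.fromℚ q)
    ; exp     = expSeries
    }

-- Series in two variables r and t are series in r whose coefficients are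
-- series in t.

module Bivariate (K : RawExpAlgebra c ℓ) where
  private
    module K  = RawExpAlgebra K
    K⟦t⟧      = powerSeries K
    K⟦t⟧⟦r⟧   = powerSeries K⟦t⟧
    open RawExpAlgebra K⟦t⟧⟦r⟧

  r t : Carrier
  r = var K⟦t⟧
  t = const K⟦t⟧ (var K)

  -- F(r,t) ↦ F(t,t)
  setr=t : Carrier → Series K
  setr=t F n = K.sum {suc n} λ i → F (toℕ i) (n ∸ toℕ i)

  -- F(r,t) ↦ ∫₀ᵗ F(r,t) dr
  ∫₀ᵗ_dr : Carrier → Series K
  ∫₀ᵗ F dr = setr=t (∫₀ K⟦t⟧ F)

  -- r^m/m! · e^(r - e^t)
  integrand : ℕ → Carrier
  integrand m = fromℚ (1/ m !) * r ^ m * exp (r - exp t)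

{-# OPTIONS --safe #-}

-- Remove the least letter x from a permutation avoiding 1-23: it has the form
-- σ x τ, where τ is decreasing and σ is an arbitrary avoider on its own letters.
-- For k ≥ 2 the word σ x τ begins with (k-1)(k-2)⋯1k iff σ does, or σ is the
-- decreasing word on k-2 letters and the largest letter follows x. With
-- N = N-1-23 (startPattern k) this gives
--   N (n+1) = Σᵢ (n choose i) N i + (n-1 choose k-2),
-- the last summand being absent for n = 0 or k = 1. On exponential generating
-- functions this is the linear equation y′ = eˣ y + b. Formal series over a
-- ℚ-algebra are determined by their derivative and constant term, so it remains
-- to check that the right-hand sides solve it. Exponentials of series are
-- handled through (exp f)′ = f′ exp f, which also makes the series over an
-- ExpAlgebra an ExpAlgebra again, so that the bivariate integrand needs no
-- separate theory.
module Submission where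

open import Algebra.Bundles using (CommutativeRing)
open import Algebra.Bundles.Raw using (RawRing)
open import Algebra.Morphism.Structures using (IsMonoidHomomorphism; IsRingHomomorphism)
import Algebra.Properties.CommutativeSemigroup as CommutativeSemigroupProperties
import Algebra.Properties.Ring as RingProperties
import Algebra.Properties.Semiring.Sum as SemiringSum
open import Data.Empty using (⊥-elim)
open import Data.Fin.Base as Fin using (Fin; zero; suc; toℕ; fromℕ; inject₁)
import Data.Fin.Properties as Fin
open import Data.Fin.Relation.Unary.Top as Top using (‵fromℕ; ‵inject₁)
import Data.Integer.Base as ℤ
import Data.Integer.Properties as ℤ
open import Data.List.Base as List using (List; []; _∷_; [_]; _++_; concatMap; filter; length; map; reverse)
open import Data.List.Membership.DecPropositional using () renaming (_∈?_ to member?)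
open import Data.List.Membership.Propositional using (_∈_; _∉_; find; lose)
open import Data.List.Membership.Propositional.Properties
  using (∈-++⁺ˡ; ∈-++⁺ʳ; ∈-++⁻; ∈-map⁺; ∈-map⁻; ∈-concatMap⁺; ∈-concatMap⁻; ∈-∃++; ∈-filter⁺; ∈-filter⁻;
         ∈-allFin; ∈-cartesianProductWith⁺)
open import Data.List.Membership.Propositional.Properties.WithK using (unique∧set⇒bag)
import Data.List.Properties as List
open import Data.List.Relation.Binary.BagAndSetEquality using (∼bag⇒↭)
open import Data.List.Relation.Binary.Disjoint.Propositional using (Disjoint)
open import Data.List.Relation.Binary.Permutation.Propositional
  using (_↭_; ↭-refl; ↭-sym; ↭-trans; ↭-prep; ↭⇒↭ₛ; module PermutationReasoning)
open import Data.List.Relation.Binary.Permutation.Propositional.Properties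
  using (All-resp-↭; ∈-resp-↭; ↭-length; ↭-reverse; ↭-empty-inv; ++⁺; drop-mid; drop-∷) renaming (shift to ↭-shift)
import Data.List.Relation.Binary.Permutation.Setoid.Properties as Setoid↭
open import Data.List.Relation.Ternary.Interleaving.Propositional
  using (Interleaving; []; consˡ; consʳ; toPermutation)
open import Data.List.Relation.Unary.All as All using (All; []; _∷_)
import Data.List.Relation.Unary.All.Properties as All
open import Data.List.Relation.Unary.AllPairs as AllPairs using (AllPairs; []; _∷_)
import Data.List.Relation.Unary.AllPairs.Properties as AllPairs
open import Data.List.Relation.Unary.Any using (here; there)
open import Data.List.Relation.Unary.Linked as Linked using (Linked; []; [-]; _∷_)
import Data.List.Relation.Unary.Linked.Properties as Linked
open import Data.List.Relation.Unary.Unique.Propositional using (Unique)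
import Data.List.Relation.Unary.Unique.Propositional.Properties as Unique
open import Data.Nat.Base as ℕ using (ℕ; zero; suc; NonZero; _≤_; z≤n; s≤s; _∸_; _!)
import Data.Nat.Properties as ℕ
open import Data.Product.Base using (∃-syntax; _×_; _,_; proj₁; proj₂; map₁; map₂)
open import Data.Rational.Base as ℚ using (ℚ)
import Data.Rational.Properties as ℚ
import Data.Rational.Unnormalised.Base as ℚᵘ
import Data.Rational.Unnormalised.Properties as ℚᵘ
open import Data.Sum.Base using (_⊎_; inj₁; inj₂)
open import Data.Unit.Base using (⊤; tt)
open import Data.Vec.Base as Vec using (Vec; []; _∷_; lookup; toList; fromList; truncate; _∷ʳ_; initLast)
import Data.Vec.Properties as Vec
import Data.Vec.Relation.Unary.All as VecAll
import Data.Vec.Relation.Unary.All.Properties as VecAll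
open import Data.Vec.Relation.Unary.AllPairs using ([]; _∷_)
import Data.Vec.Relation.Unary.Unique.Propositional as Vec
import Data.Vec.Relation.Unary.Unique.Propositional.Properties as VecUnique
open import Defs
open import Function.Base using (_∘_; _on_)
open import Function.Bundles using (_⇔_; mk⇔; module Equivalence)
open import Level using (Level)
open import Relation.Binary.Definitions using (tri<; tri≈; tri>)
open import Relation.Binary.PropositionalEquality as ≡ using (_≡_; _≢_)
import Relation.Binary.Reasoning.Setoid as SetoidReasoning
open import Relation.Nullary.Decidable using (yes; no; _×-dec_)
open import Relation.Nullary.Negation using (¬_)

-- The largest letter enters through the decreasing block. The first letter of τ is its maximum, and
-- if the pattern straddles x it exceeds all of σ too, so it is the largest letter of the word; the
-- other n-1 letters larger than x supply the k-2 letters of σ. Removing x leaves letters that no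
-- longer form an initial segment. Instead of standardising, words are lists over `Fin N`, and the
-- combinatorics is done for rearrangements of an arbitrary increasing list of letters, on whose
-- length alone the count depends. The inhomogeneous term b is the generating function of (n-1
-- choose k-2), which is the integral of r^(k-2)/(k-2)! e^r from 0 to x. As e^(e^x) solves the
-- homogeneous equation, variation of constants divides b by it before the outer integration: this
-- is the origin of e^(-e^t) in the integrand. In r the exponent r - e^t has constant coefficient
-- -e^t, whose own constant coefficient in t is -1, so an exponential of a nonzero constant is met
-- at both levels.

private
  variable
    c ℓ : Level
    X Y : Set
    N : ℕ

-- Formal power series as a commutative ring with an exponential

_/ℕ_ : ℕ → (d : ℕ) .{{_ : NonZero d}} → ℚ
a /ℕ d = (ℤ.+ a) ℚ./ d

/ℕ-cross : ∀ a b d e .{{_ : NonZero d}} .{{_ : NonZero e}} →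
           a ℕ.* e ≡ b ℕ.* d → a /ℕ d ≡ b /ℕ e
/ℕ-cross a b (suc d) (suc e) eq =
  ℚ.fromℚᵘ-cong {ℚᵘ.mkℚᵘ (ℤ.+ a) d} {ℚᵘ.mkℚᵘ (ℤ.+ b) e}
    (ℚᵘ.*≡* (≡.trans (≡.sym (ℤ.pos-* a (suc e)))
                     (≡.trans (≡.cong ℤ.+_ eq) (ℤ.pos-* b (suc d)))))

-- `ℚ._/_` reduces by a gcd that is stuck on variables, so the comparison takes place among
-- unnormalised fractions.
/ℕ-* : ∀ a b d e .{{_ : NonZero d}} .{{_ : NonZero e}} .{{_ : NonZero (d ℕ.* e)}} →
       (a /ℕ d) ℚ.* (b /ℕ e) ≡ (a ℕ.* b) /ℕ (d ℕ.* e)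
/ℕ-* a b (suc d) (suc e) = ℚ.toℚᵘ-injective (begin
  ℚ.toℚᵘ ((a /ℕ suc d) ℚ.* (b /ℕ suc e))             ≈⟨ ℚ.toℚᵘ-homo-* (a /ℕ suc d) (b /ℕ suc e) ⟩
  ℚ.toℚᵘ (a /ℕ suc d) ℚᵘ.* ℚ.toℚᵘ (b /ℕ suc e)
    ≈⟨ ℚᵘ.*-cong (ℚ.toℚᵘ-fromℚᵘ (ℚᵘ.mkℚᵘ (ℤ.+ a) d)) (ℚ.toℚᵘ-fromℚᵘ (ℚᵘ.mkℚᵘ (ℤ.+ b) e)) ⟩
  ℚᵘ.mkℚᵘ (ℤ.+ a) d ℚᵘ.* ℚᵘ.mkℚᵘ (ℤ.+ b) e
    ≈⟨ ℚᵘ.≃-reflexive (≡.cong (λ z → ℚᵘ.mkℚᵘ z (e ℕ.+ d ℕ.* suc e)) (≡.sym (ℤ.pos-* a b))) ⟩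
  ℚᵘ.mkℚᵘ (ℤ.+ (a ℕ.* b)) (e ℕ.+ d ℕ.* suc e)        ≈⟨ ℚ.toℚᵘ-fromℚᵘ _ ⟨
  ℚ.toℚᵘ ((a ℕ.* b) /ℕ (suc d ℕ.* suc e))            ∎)
  where open ℚᵘ.≃-Reasoning

/ℕ-+ : ∀ a b d .{{_ : NonZero d}} → (a /ℕ d) ℚ.+ (b /ℕ d) ≡ (a ℕ.+ b) /ℕ d
/ℕ-+ a b (suc d) = ℚ.toℚᵘ-injective (begin
  ℚ.toℚᵘ ((a /ℕ suc d) ℚ.+ (b /ℕ suc d))             ≈⟨ ℚ.toℚᵘ-homo-+ (a /ℕ suc d) (b /ℕ suc d) ⟩
  ℚ.toℚᵘ (a /ℕ suc d) ℚᵘ.+ ℚ.toℚᵘ (b /ℕ suc d)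
    ≈⟨ ℚᵘ.+-cong (ℚ.toℚᵘ-fromℚᵘ (ℚᵘ.mkℚᵘ (ℤ.+ a) d)) (ℚ.toℚᵘ-fromℚᵘ (ℚᵘ.mkℚᵘ (ℤ.+ b) d)) ⟩
  ℚᵘ.mkℚᵘ (ℤ.+ a) d ℚᵘ.+ ℚᵘ.mkℚᵘ (ℤ.+ b) d           ≈⟨ ℚᵘ.*≡* cross ⟩
  ℚᵘ.mkℚᵘ (ℤ.+ (a ℕ.+ b)) d                          ≈⟨ ℚ.toℚᵘ-fromℚᵘ _ ⟨
  ℚ.toℚᵘ ((a ℕ.+ b) /ℕ suc d)                        ∎)
  where
  open ℚᵘ.≃-Reasoning
  D = ℤ.+ suc d
  cross : (ℤ.+ a ℤ.* D ℤ.+ ℤ.+ b ℤ.* D) ℤ.* D ≡ ℤ.+ (a ℕ.+ b) ℤ.* (D ℤ.* D)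
  cross = ≡.trans (≡.cong (ℤ._* D) (≡.trans (≡.sym (ℤ.*-distribʳ-+ D (ℤ.+ a) (ℤ.+ b)))
                                            (≡.cong (ℤ._* D) (≡.sym (ℤ.pos-+ a b)))))
                  (ℤ.*-assoc (ℤ.+ (a ℕ.+ b)) D D)

ι : ℕ → ℚ
ι n = n /ℕ 1

/ℕ-ι : ∀ a b d e .{{_ : NonZero d}} .{{_ : NonZero e}} → a ℕ.* b ℕ.* e ≡ a ℕ.* d → (a /ℕ d) ℚ.* ι b ≡ a /ℕ e
/ℕ-ι a b d e {{nz}} eq = ≡.trans (/ℕ-* a b d 1 {{nz}} {{ℕ.nonZero}} {{ℕ.m*n≢0 d 1}})
  (/ℕ-cross (a ℕ.* b) a (d ℕ.* 1) e {{ℕ.m*n≢0 d 1}} (≡.trans eq (≡.cong (a ℕ.*_) (≡.sym (ℕ.*-identityʳ d)))))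

/ℕ!-ι : ∀ a n → ((a /ℕ (suc n !)) {{suc n ℕ.!≢0}}) ℚ.* ι (suc n) ≡ (a /ℕ (n !)) {{n ℕ.!≢0}}
/ℕ!-ι a n = /ℕ-ι a (suc n) (suc n !) (n !) {{suc n ℕ.!≢0}} {{n ℕ.!≢0}} (ℕ.*-assoc a (suc n) (n !))

1/-ι : ∀ n → (1 /ℕ suc n) ℚ.* ι (suc n) ≡ ℚ.1ℚ
1/-ι n = /ℕ-ι 1 (suc n) (suc n) 1 (ℕ.*-identityʳ (1 ℕ.* suc n))

ι-+ : ∀ m n → ι (m ℕ.+ n) ≡ ι m ℚ.+ ι n
ι-+ m n = ≡.sym (/ℕ-+ m n 1)

module SeriesRing (A : ExpAlgebra c ℓ) where
  open ExpAlgebra A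
  open CommutativeRing commutativeRing
  open SemiringSum semiring using (sum; sum-cong-≋; ∑-distrib-+; *-distribˡ-sum)
  open import Relation.Binary.Reasoning.Setoid setoid

  private
    K = rawExpAlgebra
    module S = RawRing (seriesRawRing K)
    variable
      f g f′ g′ : Series K

  open S using () renaming (_≈_ to infix 4 _≋_; _+_ to infixl 6 _⊕_; _*_ to infixl 7 _⊛_) public

  shift : Series K → Series K
  shift f n = f (suc n)

  infixr 8 _•_
  _•_ : Carrier → Series K → Series K
  (a • f) n = a * f n

  -- Causality of the Cauchy product: coefficient `n` reads no coefficient beyond `n`. Uniqueness
  -- for differential equations and the truncated exponential sums both rest on it.
  ⊛-cong≤ : ∀ n → (∀ i → i ≤ n → f i ≈ f′ i) → (∀ i → i ≤ n → g i ≈ g′ i) →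
            (f ⊛ g) n ≈ (f′ ⊛ g′) n
  ⊛-cong≤ {f} {f′} {g} {g′} n p q = sum-cong-≋ {suc n} λ i →
    *-cong (p (toℕ i) (ℕ.≤-pred (Fin.toℕ<n i))) (q (n ∸ toℕ i) (ℕ.m∸n≤m n (toℕ i)))

  ⊛-cong : f ≋ f′ → g ≋ g′ → f ⊛ g ≋ f′ ⊛ g′
  ⊛-cong {f} {f′} {g} {g′} p q n = ⊛-cong≤ {f} {f′} {g} {g′} n (λ i _ → p i) (λ i _ → q i)

  ⊛-congʳ : ∀ g → f ≋ f′ → f ⊛ g ≋ f′ ⊛ g
  ⊛-congʳ {f} {f′} g p = ⊛-cong {f} {f′} {g} {g} p λ _ → refl

  ⊛-distribʳ : ∀ f g h → (g ⊕ h) ⊛ f ≋ (g ⊛ f) ⊕ (h ⊛ f)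
  ⊛-distribʳ f g h n = trans
    (sum-cong-≋ {suc n} λ i → distribʳ (f (n ∸ toℕ i)) (g (toℕ i)) (h (toℕ i)))
    (∑-distrib-+ {suc n} (λ i → g (toℕ i) * f (n ∸ toℕ i)) (λ i → h (toℕ i) * f (n ∸ toℕ i)))

  •-⊛ : ∀ a f g → (a • f) ⊛ g ≋ a • (f ⊛ g)
  •-⊛ a f g n = trans
    (sum-cong-≋ {suc n} λ i → *-assoc a (f (toℕ i)) (g (n ∸ toℕ i)))
    (sym (*-distribˡ-sum {suc n} a (λ i → f (toℕ i) * g (n ∸ toℕ i))))

  -- `S.0#` is this series; it computes only after a case split on the index, hence the explicit
  -- conversions below.
  const-0 : ∀ n → const K 0# n ≈ 0#
  const-0 zero    = refl
  const-0 (suc n) = refl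

  zero-⊛ : ∀ g → S.0# ⊛ g ≋ S.0#
  zero-⊛ g n = begin
    (S.0# ⊛ g) n        ≈⟨ ⊛-congʳ {S.0#} {0# • g} g (λ i → trans (const-0 i) (sym (zeroˡ (g i)))) n ⟩
    ((0# • g) ⊛ g) n    ≈⟨ •-⊛ 0# g g n ⟩
    0# * (g ⊛ g) n      ≈⟨ zeroˡ _ ⟩
    0#                  ≈⟨ const-0 n ⟨
    S.0# n              ∎

  const-⊛ : ∀ a f → const K a ⊛ f ≋ a • f
  const-⊛ a f zero    = +-identityʳ _
  const-⊛ a f (suc n) = begin
    a * f (suc n) + (shift (const K a) ⊛ f) n
      ≈⟨ +-congˡ (⊛-congʳ {shift (const K a)} {S.0#} f (λ i → sym (const-0 i)) n) ⟩
    a * f (suc n) + (S.0# ⊛ f) n              ≈⟨ +-congˡ (zero-⊛ f n) ⟩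
    a * f (suc n) + S.0# n                    ≈⟨ +-congˡ (const-0 n) ⟩
    a * f (suc n) + 0#                        ≈⟨ +-identityʳ _ ⟩
    a * f (suc n)                             ∎

  -- By computation a product unfolds at its first factor, into `f 0 * g (suc n) + (shift f ⊛ g) n`.
  -- Commutativity needs this mirror image, which peels off the second factor.
  shift-⊛ʳ : ∀ f g n → (f ⊛ g) (suc n) ≈ (f ⊛ shift g) n + f (suc n) * g 0
  shift-⊛ʳ f g zero    = begin
    f 0 * g 1 + (f 1 * g 0 + 0#)   ≈⟨ +-congˡ (+-identityʳ _) ⟩
    f 0 * g 1 + f 1 * g 0          ≈⟨ +-congʳ (+-identityʳ _) ⟨
    f 0 * g 1 + 0# + f 1 * g 0     ∎
  shift-⊛ʳ f g (suc n) = begin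
    f 0 * g (2 ℕ.+ n) + (shift f ⊛ g) (suc n)
      ≈⟨ +-congˡ (shift-⊛ʳ (shift f) g n) ⟩
    f 0 * g (2 ℕ.+ n) + ((shift f ⊛ shift g) n + f (2 ℕ.+ n) * g 0)             ≈⟨ +-assoc _ _ _ ⟨
    f 0 * g (2 ℕ.+ n) + (shift f ⊛ shift g) n + f (2 ℕ.+ n) * g 0               ∎

  ⊛-comm : ∀ f g → f ⊛ g ≋ g ⊛ f
  ⊛-comm f g zero    = +-congʳ (*-comm _ _)
  ⊛-comm f g (suc n) = begin
    f 0 * g (suc n) + (shift f ⊛ g) n  ≈⟨ +-cong (*-comm _ _) (⊛-comm (shift f) g n) ⟩
    g (suc n) * f 0 + (g ⊛ shift f) n  ≈⟨ +-comm _ _ ⟩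
    (g ⊛ shift f) n + g (suc n) * f 0  ≈⟨ shift-⊛ʳ g f n ⟨
    (g ⊛ f) (suc n)                    ∎

  -- `shift (f ⊛ g)` is `f 0 • shift g ⊕ shift f ⊛ g` by computation, so induction on the index
  -- replaces the reindexing of a double sum.
  ⊛-assoc : ∀ f g h → (f ⊛ g) ⊛ h ≋ f ⊛ (g ⊛ h)
  ⊛-assoc f g h zero    = begin
    (f 0 * g 0 + 0#) * h 0 + 0#   ≈⟨ +-congʳ (*-congʳ (+-identityʳ _)) ⟩
    f 0 * g 0 * h 0 + 0#          ≈⟨ +-congʳ (*-assoc _ _ _) ⟩
    f 0 * (g 0 * h 0) + 0#        ≈⟨ +-congʳ (*-congˡ (+-identityʳ _)) ⟨
    f 0 * (g 0 * h 0 + 0#) + 0#   ∎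
  ⊛-assoc f g h (suc n) = begin
    (f 0 * g 0 + 0#) * h (suc n) + ((f 0 • shift g ⊕ shift f ⊛ g) ⊛ h) n
      ≈⟨ +-cong (trans (*-congʳ (+-identityʳ _)) (*-assoc _ _ _)) (⊛-distribʳ h (f 0 • shift g) (shift f ⊛ g) n) ⟩
    f 0 * (g 0 * h (suc n)) + (((f 0 • shift g) ⊛ h) n + ((shift f ⊛ g) ⊛ h) n)
      ≈⟨ +-congˡ (+-cong (•-⊛ (f 0) (shift g) h n) (⊛-assoc (shift f) g h n)) ⟩
    f 0 * (g 0 * h (suc n)) + (f 0 * (shift g ⊛ h) n + (shift f ⊛ (g ⊛ h)) n)
      ≈⟨ +-assoc _ _ _ ⟨
    f 0 * (g 0 * h (suc n)) + f 0 * (shift g ⊛ h) n + (shift f ⊛ (g ⊛ h)) n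
      ≈⟨ +-congʳ (distribˡ _ _ _) ⟨
    f 0 * (g 0 * h (suc n) + (shift g ⊛ h) n) + (shift f ⊛ (g ⊛ h)) n ∎

  const-cong : ∀ {a b} → a ≈ b → const K a ≋ const K b
  const-cong eq zero    = eq
  const-cong eq (suc n) = refl

  ⊛-identityˡ : ∀ f → S.1# ⊛ f ≋ f
  ⊛-identityˡ f n = trans (const-⊛ 1# f n) (*-identityˡ _)

  const-+ : ∀ a b → const K (a + b) ≋ const K a ⊕ const K b
  const-+ a b zero    = refl
  const-+ a b (suc n) = sym (+-identityˡ _)

  const-* : ∀ a b → const K (a * b) ≋ const K a ⊛ const K b
  const-* a b zero    = sym (+-identityʳ _)
  const-* a b (suc n) = sym (trans (const-⊛ a (const K b) (suc n)) (zeroʳ _))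

  const-neg : ∀ a → const K (- a) ≋ S.- const K a
  const-neg a zero    = refl
  const-neg a (suc n) = sym -0#≈0#
    where open RingProperties ring using (-0#≈0#)

  seriesRing : CommutativeRing _ _
  seriesRing = record
    { Carrier = Series K
    ; _≈_ = S._≈_ ; _+_ = S._+_ ; _*_ = S._*_ ; -_ = S.-_ ; 0# = S.0# ; 1# = S.1#
    ; isCommutativeRing = record
      { isRing = record
        { +-isAbelianGroup = record
          { isGroup = record
            { isMonoid = record
              { isSemigroup = record
                { isMagma = record
                  { isEquivalence = record
                    { refl = λ _ → refl ; sym = λ p n → sym (p n) ; trans = λ p q n → trans (p n) (q n) }
                  ; ∙-cong = λ p q n → +-cong (p n) (q n)
                  }
                ; assoc = λ f g h n → +-assoc (f n) (g n) (h n)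
                }
              ; identity = (λ f n → trans (+-congʳ (const-0 n)) (+-identityˡ _))
                         , (λ f n → trans (+-congˡ (const-0 n)) (+-identityʳ _))
              }
            ; inverse = (λ f n → trans (-‿inverseˡ (f n)) (sym (const-0 n)))
                      , (λ f n → trans (-‿inverseʳ (f n)) (sym (const-0 n)))
            ; ⁻¹-cong = λ p n → -‿cong (p n)
            }
          ; comm = λ f g n → +-comm (f n) (g n)
          }
        ; *-cong = ⊛-cong
        ; *-assoc = ⊛-assoc
        ; *-identity = ⊛-identityˡ , λ f n → trans (⊛-comm f S.1# n) (⊛-identityˡ f n)
        ; distrib = (λ f g h n → trans (⊛-comm f (g ⊕ h) n) (trans (⊛-distribʳ f g h n)
                      (+-cong (⊛-comm g f n) (⊛-comm h f n))))
                  , ⊛-distribʳ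
        }
      ; *-comm = ⊛-comm
      }
    }

-- Differentiation, linear differential equations and the exponential of a series

module ExpODE (A : ExpAlgebra c ℓ) where
  open ExpAlgebra A
  open CommutativeRing commutativeRing
  open SemiringSum semiring using (sum; sum-cong-≋; ∑-distrib-+; *-distribˡ-sum)
  open CommutativeSemigroupProperties *-commutativeSemigroup using (x∙yz≈y∙xz)
  open SeriesRing A public
  open IsRingHomomorphism fromℚ-isRingHomomorphism using () renaming
    (⟦⟧-cong to fromℚ-cong; +-homo to fromℚ-+; *-homo to fromℚ-*; 0#-homo to fromℚ-0; 1#-homo to fromℚ-1)
  open IsMonoidHomomorphism exp-isMonoidHomomorphism using () renaming
    (⟦⟧-cong to exp-cong; homo to exp-+; ε-homo to exp-0)

  private
    K = rawExpAlgebra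
    module S = CommutativeRing seriesRing
    module ≈-Reasoning = SetoidReasoning setoid
    module ≋-Reasoning = SetoidReasoning S.setoid
    variable
      f g : Series K
  open RawExpAlgebra (powerSeries K) using (_^_)

  ιᴷ : ℕ → Carrier
  ιᴷ n = fromℚ (ι n)

  ιᴷ-+ : ∀ m n → ιᴷ (m ℕ.+ n) ≈ ιᴷ m + ιᴷ n
  ιᴷ-+ m n = trans (fromℚ-cong (ι-+ m n)) (fromℚ-+ _ _)

  -- `θ` is the Euler operator x d/dx. Unlike `D` it preserves degrees, which makes its product rule
  -- a termwise statement.
  θ D : Series K → Series K
  θ f n = ιᴷ n * f n
  D f n = ιᴷ (suc n) * f (suc n)

  D-cong : f ≋ g → D f ≋ D g
  D-cong p n = *-congˡ (p (suc n))

  D-• : ∀ a f → D (a • f) ≋ a • D f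
  D-• a f n = x∙yz≈y∙xz (ιᴷ (suc n)) a (f (suc n))

  D-⊕ : ∀ f g → D (f ⊕ g) ≋ D f ⊕ D g
  D-⊕ f g n = distribˡ (ιᴷ (suc n)) (f (suc n)) (g (suc n))

  D-neg : ∀ f → D (S.- f) ≋ S.- D f
  D-neg f n = sym (-‿distribʳ-* (ιᴷ (suc n)) (f (suc n)))
    where open RingProperties ring using (-‿distribʳ-*)

  D-const : ∀ a → D (const K a) ≋ S.0#
  D-const a n = trans (zeroʳ _) (sym (const-0 n))

  •-cong : ∀ {a b} → a ≈ b → f ≋ g → a • f ≋ b • g
  •-cong p q n = *-cong p (q n)

  •-assoc : ∀ a b f → a • b • f ≋ (a * b) • f
  •-assoc a b f n = sym (*-assoc a b (f n))

  ⊛-• : ∀ a f g → f ⊛ (a • g) ≋ a • (f ⊛ g)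
  ⊛-• a f g = begin
    f ⊛ (a • g)  ≈⟨ ⊛-comm f (a • g) ⟩
    (a • g) ⊛ f  ≈⟨ •-⊛ a g f ⟩
    a • (g ⊛ f)  ≈⟨ •-cong refl (⊛-comm g f) ⟩
    a • (f ⊛ g)  ∎
    where open ≋-Reasoning

  -- Summand `i` of coefficient `n` pairs degrees `i` and `n ∸ i`, and the weight `n` splits as
  -- their sum.
  θ-⊛ : ∀ f g → θ (f ⊛ g) ≋ θ f ⊛ g ⊕ f ⊛ θ g
  θ-⊛ f g n = begin
    ιᴷ n * (f ⊛ g) n
      ≈⟨ *-distribˡ-sum {suc n} (ιᴷ n) (λ i → f (toℕ i) * g (n ∸ toℕ i)) ⟩
    sum {suc n} (λ i → ιᴷ n * (f (toℕ i) * g (n ∸ toℕ i)))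
      ≈⟨ sum-cong-≋ {suc n} term ⟩
    sum {suc n} (λ i → θ f (toℕ i) * g (n ∸ toℕ i) + f (toℕ i) * θ g (n ∸ toℕ i))
      ≈⟨ ∑-distrib-+ {suc n} (λ i → θ f (toℕ i) * g (n ∸ toℕ i)) (λ i → f (toℕ i) * θ g (n ∸ toℕ i)) ⟩
    (θ f ⊛ g ⊕ f ⊛ θ g) n ∎
    where
    open ≈-Reasoning
    term : ∀ (i : Fin (suc n)) → ιᴷ n * (f (toℕ i) * g (n ∸ toℕ i)) ≈
           θ f (toℕ i) * g (n ∸ toℕ i) + f (toℕ i) * θ g (n ∸ toℕ i)
    term i = begin
      ιᴷ n * (a * b)
        ≡⟨ ≡.cong (λ m → ιᴷ m * (a * b)) (ℕ.m+[n∸m]≡n {j} (ℕ.≤-pred (Fin.toℕ<n i))) ⟨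
      ιᴷ (j ℕ.+ (n ∸ j)) * (a * b)         ≈⟨ *-congʳ (ιᴷ-+ j (n ∸ j)) ⟩
      (ιᴷ j + ιᴷ (n ∸ j)) * (a * b)        ≈⟨ distribʳ _ _ _ ⟩
      ιᴷ j * (a * b) + ιᴷ (n ∸ j) * (a * b) ≈⟨ +-cong (sym (*-assoc _ _ _)) (x∙yz≈y∙xz _ _ _) ⟩
      ιᴷ j * a * b + a * (ιᴷ (n ∸ j) * b)  ∎
      where
      j = toℕ i
      a = f j
      b = g (n ∸ j)

  shift-θ-⊛ : ∀ f g n → (θ f ⊛ g) (suc n) ≈ (D f ⊛ g) n
  shift-θ-⊛ f g n = begin
    ιᴷ 0 * f 0 * g (suc n) + (D f ⊛ g) n ≈⟨ +-congʳ (*-congʳ (trans (*-congʳ fromℚ-0) (zeroˡ _))) ⟩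
    0# * g (suc n) + (D f ⊛ g) n         ≈⟨ +-congʳ (zeroˡ _) ⟩
    0# + (D f ⊛ g) n                     ≈⟨ +-identityˡ _ ⟩
    (D f ⊛ g) n                          ∎
    where open ≈-Reasoning

  D-⊛ : ∀ f g → D (f ⊛ g) ≋ D f ⊛ g ⊕ f ⊛ D g
  D-⊛ f g n = begin
    θ (f ⊛ g) (suc n)                        ≈⟨ θ-⊛ f g (suc n) ⟩
    (θ f ⊛ g) (suc n) + (f ⊛ θ g) (suc n)    ≈⟨ +-cong (shift-θ-⊛ f g n) (⊛-comm f (θ g) (suc n)) ⟩
    (D f ⊛ g) n + (θ g ⊛ f) (suc n)          ≈⟨ +-congˡ (trans (shift-θ-⊛ g f n) (⊛-comm (D g) f n)) ⟩
    (D f ⊛ g ⊕ f ⊛ D g) n                    ∎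
    where open ≈-Reasoning

  ι-inverse : ∀ n a → fromℚ (1 /ℕ suc n) * (ιᴷ (suc n) * a) ≈ a
  ι-inverse n a = begin
    fromℚ (1 /ℕ suc n) * (ιᴷ (suc n) * a) ≈⟨ *-assoc _ _ _ ⟨
    fromℚ (1 /ℕ suc n) * ιᴷ (suc n) * a   ≈⟨ *-congʳ (fromℚ-* _ _) ⟨
    fromℚ (1 /ℕ suc n ℚ.* ι (suc n)) * a  ≈⟨ *-congʳ (trans (fromℚ-cong (1/-ι n)) fromℚ-1) ⟩
    1# * a                                ≈⟨ *-identityˡ a ⟩
    a                                     ∎
    where open ≈-Reasoning

  -- The integer `suc n` is invertible in a ℚ-algebra. The claim concerns a single coefficient so
  -- that it can serve inside inductions on the index.
  D-injective : ∀ f g n → D f n ≈ D g n → f (suc n) ≈ g (suc n)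
  D-injective f g n p = trans (sym (ι-inverse n _)) (trans (*-congˡ p) (ι-inverse n _))

  D-∫₀ : ∀ f → D (∫₀ K f) ≋ f
  D-∫₀ f n = trans (x∙yz≈y∙xz _ _ _) (ι-inverse n (f n))

  -- The equation expresses coefficient i+1 through coefficients up to i, because a product is
  -- causal.
  linearODE-unique : ∀ p q {y z} → D y ≋ p ⊛ y ⊕ q → D z ≋ p ⊛ z ⊕ q → y 0 ≈ z 0 → y ≋ z
  linearODE-unique p q {y} {z} Dy Dz y₀≈z₀ n = agree n n ℕ.≤-refl
    where
    open ≈-Reasoning
    -- The bound `n` turns strong induction on `i` into structural recursion.
    agree : ∀ n i → i ≤ n → y i ≈ z i
    agree n       zero    _         = y₀≈z₀
    agree (suc n) (suc i) (s≤s i≤n) = D-injective y z i (begin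
      D y i              ≈⟨ Dy i ⟩
      (p ⊛ y) i + q i    ≈⟨ +-congʳ (⊛-cong≤ {p} {p} {y} {z} i (λ _ _ → refl)
                              λ j j≤i → agree n j (ℕ.≤-trans j≤i i≤n)) ⟩
      (p ⊛ z) i + q i    ≈⟨ Dz i ⟨
      D z i              ∎)

  homogeneousODE-unique : ∀ p {y z} → D y ≋ p ⊛ y → D z ≋ p ⊛ z → y 0 ≈ z 0 → y ≋ z
  homogeneousODE-unique p Dy Dz = linearODE-unique p S.0#
    (S.trans Dy (S.sym (S.+-identityʳ _))) (S.trans Dz (S.sym (S.+-identityʳ _)))

  D-^ : ∀ f m → D (f ^ suc m) ≋ ιᴷ (suc m) • (D f ⊛ f ^ m)
  D-^ f zero    = begin
    D (f ⊛ S.1#)                     ≈⟨ D-⊛ f S.1# ⟩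
    D f ⊛ S.1# ⊕ f ⊛ D S.1#          ≈⟨ S.+-congˡ {D f ⊛ S.1#} (S.*-congˡ {f} (D-const 1#)) ⟩
    D f ⊛ S.1# ⊕ f ⊛ S.0#            ≈⟨ S.+-congˡ {D f ⊛ S.1#} (S.zeroʳ f) ⟩
    D f ⊛ S.1# ⊕ S.0#                ≈⟨ S.+-identityʳ (D f ⊛ S.1#) ⟩
    D f ⊛ S.1#                       ≈⟨ (λ n → sym (trans (*-congʳ fromℚ-1) (*-identityˡ _))) ⟩
    ιᴷ 1 • (D f ⊛ S.1#)              ∎
    where open ≋-Reasoning
  D-^ f (suc m) = begin
    D (f ⊛ f ^ suc m)                                  ≈⟨ D-⊛ f (f ^ suc m) ⟩
    F ⊕ f ⊛ D (f ^ suc m)                              ≈⟨ S.+-congˡ {F} (S.*-congˡ {f} (D-^ f m)) ⟩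
    F ⊕ f ⊛ (ιᴷ (suc m) • (D f ⊛ f ^ m))
      ≈⟨ S.+-congˡ {F} (⊛-• (ιᴷ (suc m)) f (D f ⊛ f ^ m)) ⟩
    F ⊕ ιᴷ (suc m) • (f ⊛ (D f ⊛ f ^ m))
      ≈⟨ S.+-congˡ {F} (•-cong refl (S-x∙yz≈y∙xz f (D f) (f ^ m))) ⟩
    F ⊕ ιᴷ (suc m) • F
      ≈⟨ (λ n → +-congʳ (sym (trans (*-congʳ fromℚ-1) (*-identityˡ _)))) ⟩
    ιᴷ 1 • F ⊕ ιᴷ (suc m) • F
      ≈⟨ (λ n → trans (sym (distribʳ _ _ _)) (*-congʳ (sym (ιᴷ-+ 1 (suc m))))) ⟩
    ιᴷ (suc (suc m)) • F                               ∎
    where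
    open ≋-Reasoning
    open CommutativeSemigroupProperties S.*-commutativeSemigroup using () renaming (x∙yz≈y∙xz to S-x∙yz≈y∙xz)
    F = D f ⊛ f ^ suc m

  -- Each factor contributes at least one power of the variable. Hence the summands that `expSeries`
  -- cuts off are zero.
  ^-vanishes : f 0 ≈ 0# → ∀ {m n} → n ℕ.< m → (f ^ m) n ≈ 0#
  ^-vanishes {f} f₀ {suc m} {zero}  _         =
    trans (+-identityʳ _) (trans (*-congʳ f₀) (zeroˡ _))
  ^-vanishes {f} f₀ {suc m} {suc n} (s≤s n<m) = begin
    f 0 * (f ^ m) (suc n) + (shift f ⊛ f ^ m) n ≈⟨ +-congʳ (trans (*-congʳ f₀) (zeroˡ _)) ⟩
    0# + (shift f ⊛ f ^ m) n                    ≈⟨ +-identityˡ _ ⟩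
    (shift f ⊛ f ^ m) n
      ≈⟨ ⊛-cong≤ {shift f} {shift f} {f ^ m} {S.0#} n (λ _ _ → refl)
                                                     (λ i i≤n → trans (^-vanishes f₀ (ℕ.≤-<-trans i≤n n<m)) (sym (const-0 i))) ⟩
    (shift f ⊛ S.0#) n                          ≈⟨ S.zeroʳ (shift f) n ⟩
    S.0# n                                      ≈⟨ const-0 n ⟩
    0#                                          ∎
    where open ≈-Reasoning

  sum-vanishing-tail : ∀ {M N} (a : ℕ → Carrier) → N ≤ M → (∀ m → N ≤ m → a m ≈ 0#) →
                       sum {M} (λ i → a (toℕ i)) ≈ sum {N} (λ i → a (toℕ i))
  sum-vanishing-tail {zero}  {zero}  a _ a≈0         = refl
  sum-vanishing-tail {suc M} {zero}  a _ a≈0         =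
    trans (+-cong (a≈0 0 z≤n) (sum-vanishing-tail {M} {0} (λ m → a (suc m)) z≤n (λ m _ → a≈0 (suc m) z≤n)))
          (+-identityˡ _)
  sum-vanishing-tail {suc M} {suc N} a (s≤s N≤M) a≈0 =
    +-congˡ (sum-vanishing-tail {M} {N} (λ m → a (suc m)) N≤M (λ m N≤m → a≈0 (suc m) (s≤s N≤m)))

  partialSum : ℕ → (ℕ → Series K) → Series K
  partialSum N F n = sum {N} λ m → F (toℕ m) n

  ⊛-partialSum : ∀ h N F → h ⊛ partialSum N F ≋ partialSum N (λ m → h ⊛ F m)
  ⊛-partialSum h zero    F = begin
    h ⊛ partialSum 0 F ≈⟨ S.*-congˡ {h} {partialSum 0 F} {S.0#} (λ n → sym (const-0 n)) ⟩
    h ⊛ S.0#           ≈⟨ S.zeroʳ h ⟩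
    S.0#               ≈⟨ const-0 ⟩
    partialSum 0 (λ m → h ⊛ F m) ∎
    where open ≋-Reasoning
  ⊛-partialSum h (suc N) F = S.trans (S.distribˡ h (F 0) (partialSum N (λ m → F (suc m))))
    (S.+-congˡ {h ⊛ F 0} (⊛-partialSum h N (λ m → F (suc m))))

  expSeries₀ : ∀ f → expSeries K f 0 ≈ exp (f 0)
  expSeries₀ f = begin
    exp (f 0) * (fromℚ ℚ.1ℚ * 1# + 0#)
      ≈⟨ *-congˡ (trans (+-identityʳ _) (trans (*-identityʳ _) fromℚ-1)) ⟩
    exp (f 0) * 1#                     ≈⟨ *-identityʳ _ ⟩
    exp (f 0)                          ∎
    where open ≈-Reasoning

  module _ (f : Series K) where
    private
      g₀ = dropConst K f
      P : ℕ → Series K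
      P m = fromℚ (1/ m !) • g₀ ^ m
      E : Series K
      E n = sum {suc n} λ m → P (toℕ m) n

      D-P : ∀ m → D (P (suc m)) ≋ D g₀ ⊛ P m
      D-P m = begin
        D (P (suc m))
          ≈⟨ D-• (fromℚ (1/ suc m !)) (g₀ ^ suc m) ⟩
        fromℚ (1/ suc m !) • D (g₀ ^ suc m)                          ≈⟨ •-cong refl (D-^ g₀ m) ⟩
        fromℚ (1/ suc m !) • ιᴷ (suc m) • (D g₀ ⊛ g₀ ^ m)            ≈⟨ •-assoc _ _ (D g₀ ⊛ g₀ ^ m) ⟩
        (fromℚ (1/ suc m !) * ιᴷ (suc m)) • (D g₀ ⊛ g₀ ^ m)
          ≈⟨ •-cong (trans (sym (fromℚ-* _ _)) (fromℚ-cong (/ℕ!-ι 1 m))) S.refl ⟩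
        fromℚ (1/ m !) • (D g₀ ⊛ g₀ ^ m)                             ≈⟨ ⊛-• _ (D g₀) (g₀ ^ m) ⟨
        D g₀ ⊛ P m                                                   ∎
        where open ≋-Reasoning

      -- The number of summands of `E` varies with the index. To multiply by `D g₀`, the
      -- coefficients up to `n` have to be written with one common number of summands.
      E-stable : ∀ {n i} → i ≤ n → partialSum (suc n) P i ≈ E i
      E-stable {n} {i} i≤n = sum-vanishing-tail {suc n} {suc i} (λ m → P m i) (s≤s i≤n)
        λ m i<m → trans (*-congˡ (^-vanishes {g₀} refl i<m)) (zeroʳ _)

      -- Differentiation lowers the summation index: `P 0` is constant and `P (suc m)` yields
      -- `D g₀ ⊛ P m`. The summand gained from passing to index `suc n` makes up for the one lost.
      D-E : D E ≋ D g₀ ⊛ E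
      D-E n = begin
        ιᴷ (suc n) * sum {suc (suc n)} (λ m → P (toℕ m) (suc n))
          ≈⟨ *-distribˡ-sum {suc (suc n)} (ιᴷ (suc n)) (λ m → P (toℕ m) (suc n)) ⟩
        D (P 0) n + sum {suc n} (λ m → D (P (suc (toℕ m))) n)
          ≈⟨ +-cong (trans (*-congˡ (zeroʳ _)) (zeroʳ _)) (sum-cong-≋ {suc n} λ m → D-P (toℕ m) n) ⟩
        0# + partialSum (suc n) (λ m → D g₀ ⊛ P m) n
          ≈⟨ +-identityˡ _ ⟩
        partialSum (suc n) (λ m → D g₀ ⊛ P m) n
          ≈⟨ ⊛-partialSum (D g₀) (suc n) P n ⟨
        (D g₀ ⊛ partialSum (suc n) P) n
          ≈⟨ ⊛-cong≤ {D g₀} {D g₀} {partialSum (suc n) P} {E} n (λ _ _ → refl) (λ i → E-stable) ⟩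
        (D g₀ ⊛ E) n ∎
        where open ≈-Reasoning

    D-exp : D (expSeries K f) ≋ D f ⊛ expSeries K f
    D-exp = begin
      D (exp (f 0) • E)       ≈⟨ D-• (exp (f 0)) E ⟩
      -- `D-E` speaks of `D g₀`, which is `D f` by computation: `D` never reads the coefficient that
      -- `dropConst` clears.
      exp (f 0) • D E         ≈⟨ •-cong refl D-E ⟩
      exp (f 0) • (D f ⊛ E)   ≈⟨ ⊛-• (exp (f 0)) (D f) E ⟨
      D f ⊛ (exp (f 0) • E)   ∎
      where open ≋-Reasoning

  expSeries-cong : f ≋ g → expSeries K f ≋ expSeries K g
  expSeries-cong {f} {g} f≋g = homogeneousODE-unique (D f) (D-exp f)
    (S.trans (D-exp g) (S.*-congʳ {expSeries K g} (D-cong (S.sym f≋g))))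
    (trans (expSeries₀ f) (trans (exp-cong (f≋g 0)) (sym (expSeries₀ g))))

  expSeries-0 : expSeries K S.0# ≋ S.1#
  expSeries-0 = homogeneousODE-unique S.0#
    (S.trans (D-exp S.0#) (S.*-congʳ {expSeries K S.0#} (D-const 0#)))
    (S.trans (D-const 1#) (S.sym (S.zeroˡ S.1#)))
    (trans (expSeries₀ S.0#) exp-0)

  -- Both sides solve y′ = (f′ + g′) y with the same constant term, so no power of `f ⊕ g` has to be
  -- expanded.
  expSeries-⊕ : ∀ f g → expSeries K (f ⊕ g) ≋ expSeries K f ⊛ expSeries K g
  expSeries-⊕ f g = homogeneousODE-unique (D f ⊕ D g)
    (S.trans (D-exp (f ⊕ g)) (S.*-congʳ {expSeries K (f ⊕ g)} (D-⊕ f g)))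
    (begin
      D (F ⊛ G)                             ≈⟨ D-⊛ F G ⟩
      D F ⊛ G ⊕ F ⊛ D G
        ≈⟨ S.+-cong (S.*-congʳ {G} (D-exp f)) (S.*-congˡ {F} (D-exp g)) ⟩
      (D f ⊛ F) ⊛ G ⊕ F ⊛ (D g ⊛ G)         ≈⟨ S.+-cong (S.*-assoc (D f) F G) (S-x∙yz≈y∙xz F (D g) G) ⟩
      D f ⊛ (F ⊛ G) ⊕ D g ⊛ (F ⊛ G)         ≈⟨ S.distribʳ (F ⊛ G) (D f) (D g) ⟨
      (D f ⊕ D g) ⊛ (F ⊛ G)                 ∎)
    (trans (expSeries₀ (f ⊕ g)) (trans (exp-+ (f 0) (g 0))
      (sym (trans (+-identityʳ _) (*-cong (expSeries₀ f) (expSeries₀ g))))))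
    where
    open ≋-Reasoning
    open CommutativeSemigroupProperties S.*-commutativeSemigroup using () renaming (x∙yz≈y∙xz to S-x∙yz≈y∙xz)
    F = expSeries K f
    G = expSeries K g

  seriesAlgebra : ExpAlgebra _ _
  seriesAlgebra = record
    { commutativeRing = seriesRing
    ; fromℚ = λ q → const K (fromℚ q)
    ; fromℚ-isRingHomomorphism = record
      { isSemiringHomomorphism = record
        { isNearSemiringHomomorphism = record
          { +-isMonoidHomomorphism = record
            { isMagmaHomomorphism = record
              { isRelHomomorphism = record { cong = λ p → const-cong (fromℚ-cong p) }
              ; homo = λ p q → S.trans (const-cong (fromℚ-+ p q)) (const-+ _ _) }
            ; ε-homo = const-cong fromℚ-0 }
          ; *-homo = λ p q → S.trans (const-cong (fromℚ-* p q)) (const-* _ _) }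
        ; 1#-homo = const-cong fromℚ-1 }
      ; -‿homo = λ p → S.trans (const-cong (fromℚ-neg p)) (const-neg _)
      }
    ; exp = expSeries K
    ; exp-isMonoidHomomorphism = record
      { isMagmaHomomorphism = record
        { isRelHomomorphism = record { cong = expSeries-cong }
        ; homo = expSeries-⊕ }
      ; ε-homo = expSeries-0 }
    }
    where open IsRingHomomorphism fromℚ-isRingHomomorphism using () renaming (-‿homo to fromℚ-neg)

-- Σᵢ (n choose i) a i, written as a recursion by Pascal's rule so that it is
-- matched by the product rule for eˣ y.
binomialTransform : (ℕ → ℕ) → ℕ → ℕ
binomialTransform a zero    = a 0
binomialTransform a (suc n) = binomialTransform a n ℕ.+ binomialTransform (λ i → a (suc i)) n

-- The lower index comes first, so that `choose m` is a sequence; its exponential generating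
-- function is x^m/m! e^x.
choose : ℕ → ℕ → ℕ
choose zero    n       = 1
choose (suc m) zero    = 0
choose (suc m) (suc n) = choose m n ℕ.+ choose (suc m) n

-- The numbers (n-1 choose m), with value 0 at n = 0; the delay is integration on generating
-- functions.
delayedChoose : ℕ → ℕ → ℕ
delayedChoose m zero    = 0
delayedChoose m (suc n) = choose m n

-- Exponential generating functions

module EGF (A : ExpAlgebra c ℓ) where
  open ExpAlgebra A
  open CommutativeRing commutativeRing hiding (zero)
  open ExpODE A public
  open IsRingHomomorphism fromℚ-isRingHomomorphism using () renaming
    (⟦⟧-cong to fromℚ-cong; +-homo to fromℚ-+; *-homo to fromℚ-*; 0#-homo to fromℚ-0; 1#-homo to fromℚ-1)
  open IsMonoidHomomorphism exp-isMonoidHomomorphism using () renaming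
    (ε-homo to exp-0)

  private
    K = rawExpAlgebra
    module S = CommutativeRing seriesRing
    module ≈-Reasoning = SetoidReasoning setoid
    module ≋-Reasoning = SetoidReasoning S.setoid
  open RawExpAlgebra (powerSeries K) using (_^_) public

  D-var : D (var K) ≋ S.1#
  D-var zero    = trans (*-identityʳ _) fromℚ-1
  D-var (suc n) = zeroʳ _

  D-egf : ∀ a → D (egf K a) ≋ egf K (λ n → a (suc n))
  D-egf a n = trans (*-comm _ _) (trans (sym (fromℚ-* _ _)) (fromℚ-cong (/ℕ!-ι (a (suc n)) n)))

  egf-cong : ∀ {a b} → (∀ n → a n ≡ b n) → egf K a ≋ egf K b
  egf-cong p n = reflexive (≡.cong (λ k → fromℚ ((k /ℕ (n !)) {{n ℕ.!≢0}})) (p n))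

  egf-+ : ∀ a b → egf K a ⊕ egf K b ≋ egf K (λ n → a n ℕ.+ b n)
  egf-+ a b n = trans (sym (fromℚ-+ _ _)) (fromℚ-cong (/ℕ-+ (a n) (b n) (n !) {{n ℕ.!≢0}}))

  eˣ : Series K
  eˣ = expSeries K (var K)

  D-eˣ : D eˣ ≋ eˣ
  D-eˣ = S.trans (D-exp (var K)) (S.trans (S.*-congʳ {eˣ} D-var) (S.*-identityˡ eˣ))

  eˣ₀ : eˣ 0 ≈ 1#
  eˣ₀ = trans (expSeries₀ (var K)) exp-0

  -- The induction has to cover all sequences `a` at once, since the product rule also produces the
  -- shifted sequence.
  eˣ-⊛-egf : ∀ a → eˣ ⊛ egf K a ≋ egf K (binomialTransform a)
  eˣ-⊛-egf a zero    = trans (+-identityʳ _) (trans (*-congʳ eˣ₀) (*-identityˡ _))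
  eˣ-⊛-egf a (suc n) = D-injective (eˣ ⊛ egf K a) (egf K (binomialTransform a)) n (begin
    D (eˣ ⊛ egf K a) n
      ≈⟨ D-⊛ eˣ (egf K a) n ⟩
    (D eˣ ⊛ egf K a) n + (eˣ ⊛ D (egf K a)) n
      ≈⟨ +-cong (S.*-congʳ {egf K a} D-eˣ n) (S.*-congˡ {eˣ} (D-egf a) n) ⟩
    (eˣ ⊛ egf K a) n + (eˣ ⊛ egf K (λ i → a (suc i))) n
      ≈⟨ +-cong (eˣ-⊛-egf a n) (eˣ-⊛-egf (λ i → a (suc i)) n) ⟩
    egf K (binomialTransform a) n + egf K (binomialTransform (λ i → a (suc i))) n
      ≈⟨ egf-+ (binomialTransform a) (binomialTransform (λ i → a (suc i))) n ⟩
    egf K (λ i → binomialTransform a (suc i)) n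
      ≈⟨ D-egf (binomialTransform a) n ⟨
    D (egf K (binomialTransform a)) n ∎)
    where open ≈-Reasoning

  ∫₀-egf-choose : ∀ m → ∫₀ K (egf K (choose m)) ≋ egf K (delayedChoose m)
  ∫₀-egf-choose m zero    = sym fromℚ-0
  ∫₀-egf-choose m (suc n) = D-injective (∫₀ K (egf K (choose m))) (egf K (delayedChoose m)) n
    (trans (D-∫₀ (egf K (choose m)) n) (sym (D-egf (delayedChoose m) n)))

  -- This has the shape of `integrand` with a general exponent `u`. All that will be asked of `u` is
  -- derivative 1, so r - e^t can be treated without looking inside it.
  monomialExp : ℕ → Series K → Series K
  monomialExp m u = const K (fromℚ (1/ m !)) ⊛ var K ^ m ⊛ expSeries K u

  D-monomialExp : ∀ m u → D u ≋ S.1# →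
    D (monomialExp (suc m) u) ≋ monomialExp (suc m) u ⊕ monomialExp m u
  D-monomialExp m u Du = begin
    D (q m+1 ⊛ v m+1 ⊛ w)                      ≈⟨ D-⊛ (q m+1 ⊛ v m+1) w ⟩
    D (q m+1 ⊛ v m+1) ⊛ w ⊕ q m+1 ⊛ v m+1 ⊛ D w
      ≈⟨ S.+-comm (D (q m+1 ⊛ v m+1) ⊛ w) (q m+1 ⊛ v m+1 ⊛ D w) ⟩
    q m+1 ⊛ v m+1 ⊛ D w ⊕ D (q m+1 ⊛ v m+1) ⊛ w
      ≈⟨ S.+-cong (S.*-congˡ {q m+1 ⊛ v m+1} Dw) (S.*-congʳ {w} Dv) ⟩
    q m+1 ⊛ v m+1 ⊛ w ⊕ q m ⊛ v m ⊛ w ∎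
    where
    open ≋-Reasoning
    m+1 = suc m
    w = expSeries K u
    q v : ℕ → Series K
    q i = const K (fromℚ (1/ i !))
    v i = var K ^ i
    Dw : D w ≋ w
    Dw = S.trans (D-exp u) (S.trans (S.*-congʳ {w} Du) (S.*-identityˡ w))
    Dv : D (q m+1 ⊛ v m+1) ≋ q m ⊛ v m
    Dv = begin
      D (q m+1 ⊛ v m+1)                         ≈⟨ D-cong (const-⊛ _ (v m+1)) ⟩
      D (fromℚ (1/ m+1 !) • v m+1)              ≈⟨ D-• _ (v m+1) ⟩
      fromℚ (1/ m+1 !) • D (v m+1)              ≈⟨ •-cong refl (D-^ (var K) m) ⟩
      fromℚ (1/ m+1 !) • ιᴷ m+1 • (D (var K) ⊛ v m) ≈⟨ •-assoc _ _ (D (var K) ⊛ v m) ⟩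
      (fromℚ (1/ m+1 !) * ιᴷ m+1) • (D (var K) ⊛ v m)
        ≈⟨ •-cong (trans (sym (fromℚ-* _ _)) (fromℚ-cong (/ℕ!-ι 1 m)))
                  (S.trans (S.*-congʳ {v m} D-var) (S.*-identityˡ (v m))) ⟩
      fromℚ (1/ m !) • v m                      ≈⟨ const-⊛ _ (v m) ⟨
      q m ⊛ v m                                 ∎

  -- Derivative 1 means that `u` is `u 0` plus the variable, so e^u is `exp (u 0)` times e^x. The
  -- proof does not split `u`: for `suc m` both sides solve y′ = y + `monomialExp m u`, which on the
  -- right-hand side is Pascal's rule.
  monomialExp≋ : ∀ m u → D u ≋ S.1# → monomialExp m u ≋ exp (u 0) • egf K (choose m)
  monomialExp≋ zero u Du = homogeneousODE-unique S.1# D-lhs D-rhs (trans (W≋w 0) (trans (expSeries₀ u)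
      (sym (trans (*-congˡ fromℚ-1) (*-identityʳ _)))))
    where
    open ≋-Reasoning
    w = expSeries K u
    W = monomialExp 0 u
    G = egf K (choose 0)
    W≋w : W ≋ w
    W≋w = begin
      const K (fromℚ ℚ.1ℚ) ⊛ S.1# ⊛ w ≈⟨ S.*-congʳ {w} (S.*-identityʳ (const K (fromℚ ℚ.1ℚ))) ⟩
      const K (fromℚ ℚ.1ℚ) ⊛ w        ≈⟨ S.*-congʳ {w} (const-cong fromℚ-1) ⟩
      S.1# ⊛ w                        ≈⟨ S.*-identityˡ w ⟩
      w                               ∎
    D-lhs : D W ≋ S.1# ⊛ W
    D-lhs = begin
      D W         ≈⟨ D-cong W≋w ⟩
      D w         ≈⟨ D-exp u ⟩
      D u ⊛ w     ≈⟨ S.*-cong {D u} {S.1#} Du (S.sym W≋w) ⟩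
      S.1# ⊛ W    ∎
    D-rhs : D (exp (u 0) • G) ≋ S.1# ⊛ (exp (u 0) • G)
    D-rhs = begin
      D (exp (u 0) • G)       ≈⟨ D-• _ G ⟩
      exp (u 0) • D G         ≈⟨ •-cong refl (D-egf (choose 0)) ⟩
      exp (u 0) • G           ≈⟨ S.*-identityˡ (exp (u 0) • G) ⟨
      S.1# ⊛ (exp (u 0) • G)  ∎
  monomialExp≋ (suc m) u Du = linearODE-unique S.1# (monomialExp m u) D-lhs D-rhs
      (trans W₀ (sym (trans (*-congˡ fromℚ-0) (zeroʳ _))))
    where
    open ≋-Reasoning
    W = monomialExp (suc m) u
    G = egf K (choose (suc m))
    H = egf K (choose m)
    e₀ = exp (u 0)
    -- The positive power of `var K` contributes the factor `var K 0`, which is zero.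
    W₀ : W 0 ≈ 0#
    W₀ = trans (+-identityʳ _) (trans (*-congʳ (trans (+-identityʳ _)
      (trans (*-congˡ (trans (+-identityʳ _) (zeroˡ _))) (zeroʳ _)))) (zeroˡ _))
    D-lhs : D W ≋ S.1# ⊛ W ⊕ monomialExp m u
    D-lhs = S.trans (D-monomialExp m u Du) (S.+-congʳ {monomialExp m u} (S.sym (S.*-identityˡ W)))
    D-rhs : D (e₀ • G) ≋ S.1# ⊛ (e₀ • G) ⊕ monomialExp m u
    D-rhs = begin
      D (e₀ • G)                              ≈⟨ D-• _ G ⟩
      e₀ • D G                                ≈⟨ •-cong refl (D-egf (choose (suc m))) ⟩
      e₀ • egf K (λ n → choose m n ℕ.+ choose (suc m) n)
        ≈⟨ •-cong refl (egf-+ (choose m) (choose (suc m))) ⟨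
      e₀ • (H ⊕ G)                            ≈⟨ (λ n → distribˡ e₀ (H n) (G n)) ⟩
      e₀ • H ⊕ e₀ • G                         ≈⟨ S.+-comm (e₀ • H) (e₀ • G) ⟩
      e₀ • G ⊕ e₀ • H
        ≈⟨ S.+-cong (S.*-identityˡ (e₀ • G)) (monomialExp≋ m u Du) ⟨
      S.1# ⊛ (e₀ • G) ⊕ monomialExp m u       ∎

-- The closed forms as solutions of the differential equation

module ClosedForms (A : ExpAlgebra c ℓ) where
  open ExpAlgebra A
  open CommutativeRing commutativeRing hiding (zero)
  open SemiringSum semiring using (sum; sum-cong-≋)
  open EGF A
  open IsRingHomomorphism fromℚ-isRingHomomorphism using () renaming
    (0#-homo to fromℚ-0; 1#-homo to fromℚ-1)
  open IsMonoidHomomorphism exp-isMonoidHomomorphism using () renaming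
    (⟦⟧-cong to exp-cong; ε-homo to exp-0)

  private
    K = rawExpAlgebra
    B = seriesAlgebra
    module S = CommutativeRing seriesRing
    module B = EGF B
    module BS = CommutativeRing B.seriesRing
    module ≋-Reasoning = SetoidReasoning S.setoid
    K⟦t⟧ = powerSeries K
  open Bivariate K using (r; t; integrand; ∫₀ᵗ_dr)
  open RawExpAlgebra (powerSeries K⟦t⟧) using () renaming
    (_-_ to _-ᴮ_; exp to expᴮ; fromℚ to fromℚᴮ; _^_ to infixr 8 _^ᴮ_; _*_ to infixl 7 _*ᴮ_)

  eᵉˣ e⁻ᵉˣ : Series K
  eᵉˣ  = expSeries K eˣ
  e⁻ᵉˣ = expSeries K (S.- eˣ)

  -- This takes the place of division by the homogeneous solution. The constant terms e and 1/e
  -- cancel in it through the homomorphism law of the exponential.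
  eᵉˣ-inverse : eᵉˣ ⊛ e⁻ᵉˣ ≋ S.1#
  eᵉˣ-inverse = S.trans (S.sym (expSeries-⊕ eˣ (S.- eˣ)))
    (S.trans (expSeries-cong (S.-‿inverseʳ eˣ)) expSeries-0)

  D-eᵉˣ : D eᵉˣ ≋ eˣ ⊛ eᵉˣ
  D-eᵉˣ = S.trans (D-exp eˣ) (S.*-congʳ {eᵉˣ} D-eˣ)

  private
    u : Series K⟦t⟧
    u = r -ᴮ expᴮ t

    -- Differentiation is with respect to r. The series `t` is constant in r, and by `B.D-exp` so is
    -- its exponential.
    D-u : B.D u B.≋ BS.1#
    D-u = begin
      B.D u                          ≈⟨ B.D-⊕ r (BS.- e) ⟩
      B.D r B.⊕ B.D (BS.- e)         ≈⟨ BS.+-cong B.D-var D⟨-e⟩ ⟩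
      BS.1# B.⊕ BS.0#                ≈⟨ BS.+-identityʳ BS.1# ⟩
      BS.1#                          ∎
      where
      open SetoidReasoning BS.setoid
      open RingProperties BS.ring using (-0#≈0#)
      e = expᴮ t
      De : B.D e B.≋ BS.0#
      De = BS.trans (B.D-exp t) (BS.trans (BS.*-congʳ {e} (B.D-const (var K))) (BS.zeroˡ e))
      D⟨-e⟩ : B.D (BS.- e) B.≋ BS.0#
      D⟨-e⟩ = BS.trans (B.D-neg e) (BS.trans (BS.-‿cong De) -0#≈0#)

    -- Unfolding one operation at a time: comparing integrand m with
    -- B.monomialExp m u in a single step is too slow.
    *≡⊛ : ∀ f g → f *ᴮ g ≡ f B.⊛ g
    *≡⊛ f g = ≡.refl

    unfold-integrand : ∀ m → integrand m ≡ fromℚᴮ (1/ m !) *ᴮ (r ^ᴮ m) *ᴮ expᴮ u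
    unfold-integrand m = ≡.refl

    fold-monomialExp : ∀ m → fromℚᴮ (1/ m !) B.⊛ (r ^ᴮ m) B.⊛ expᴮ u ≡ B.monomialExp m u
    fold-monomialExp m = ≡.refl

    integrand≡ : ∀ m → integrand m ≡ B.monomialExp m u
    integrand≡ m = ≡.trans (unfold-integrand m) (≡.trans
      (≡.trans (*≡⊛ (fromℚᴮ (1/ m !) *ᴮ (r ^ᴮ m)) (expᴮ u))
               (≡.cong (B._⊛ expᴮ u) (*≡⊛ (fromℚᴮ (1/ m !)) (r ^ᴮ m))))
      (fold-monomialExp m))

    -- Taking the coefficient of r^0 descends from bivariate series to series in t, where the
    -- exponential of `t` becomes `eˣ`.
    exp-u₀ : expSeries K (u 0) ≋ e⁻ᵉˣ
    exp-u₀ = expSeries-cong (S.trans (S.+-identityˡ (S.- expᴮ t 0)) (S.-‿cong (B.expSeries₀ t)))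

  -- The factor e^(-e^t) is free of r and leaves the integral; what remains has rational
  -- coefficients. Setting r = t in a series in r alone times a series in t alone gives exactly
  -- their Cauchy product.
  ∫₀ᵗ-integrand : ∀ m → ∫₀ᵗ integrand m dr ≋ egf K (delayedChoose m) ⊛ e⁻ᵉˣ
  ∫₀ᵗ-integrand m = S.trans (S.reflexive (≡.cong ∫₀ᵗ_dr (integrand≡ m))) (S.trans
    (λ n → sum-cong-≋ {suc n} λ i → coefficient (toℕ i) (n ∸ toℕ i))
    (S.*-congʳ {e⁻ᵉˣ} (∫₀-egf-choose m)))
    where
    J = ∫₀ K (egf K (choose m))
    I = B.monomialExp m u
    G = egf K⟦t⟧ (choose m)
    -- Integration over `K⟦t⟧` only multiplies rational constants, so it gives the same numbers as
    -- over `K`.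
    constJ : ∀ i → ∫₀ K⟦t⟧ G i ≋ const K (J i)
    constJ zero    = S.refl
    constJ (suc i) = S.sym (const-* _ _)
    scaled : ∀ i → ∫₀ K⟦t⟧ I i ≋ const K (J i) ⊛ e⁻ᵉˣ
    scaled zero    = S.trans (S.sym (S.zeroˡ e⁻ᵉˣ)) (S.*-congʳ {e⁻ᵉˣ} (constJ zero))
    scaled (suc i) = begin
      q ⊛ I i                         ≈⟨ S.*-congˡ {q} (B.monomialExp≋ m u D-u i) ⟩
      q ⊛ (expSeries K (u 0) ⊛ G i)   ≈⟨ S.*-congˡ {q} (S.*-congʳ {G i} exp-u₀) ⟩
      q ⊛ (e⁻ᵉˣ ⊛ G i)                ≈⟨ S.*-congˡ {q} (S.*-comm e⁻ᵉˣ (G i)) ⟩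
      q ⊛ (G i ⊛ e⁻ᵉˣ)                ≈⟨ S.*-assoc q (G i) e⁻ᵉˣ ⟨
      (q ⊛ G i) ⊛ e⁻ᵉˣ                ≈⟨ S.*-congʳ {e⁻ᵉˣ} (constJ (suc i)) ⟩
      const K (J (suc i)) ⊛ e⁻ᵉˣ      ∎
      where
      open ≋-Reasoning
      q = const K (fromℚ (1 /ℕ suc i))
    coefficient : ∀ i j → ∫₀ K⟦t⟧ I i j ≈ J i * e⁻ᵉˣ j
    coefficient i j = trans (scaled i j) (const-⊛ (J i) e⁻ᵉˣ j)

  -- Variation of constants: differentiating `eᵉˣ` reproduces the homogeneous part, and
  -- differentiating the integral leaves `eᵉˣ ⊛ (b ⊛ e⁻ᵉˣ)`, which is `b`.
  egf≋∫ : ∀ m a → a 0 ≡ 0 → (∀ n → a (suc n) ≡ binomialTransform a n ℕ.+ delayedChoose m n) →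
          egf K a ≋ eᵉˣ ⊛ ∫₀ K (∫₀ᵗ integrand m dr)
  egf≋∫ m a a₀ rec = linearODE-unique eˣ b D-lhs D-rhs
    (trans (reflexive (≡.cong (λ k → fromℚ (k /ℕ 1)) a₀)) (trans fromℚ-0
      (sym (trans (+-identityʳ _) (zeroʳ _)))))
    where
    open ≋-Reasoning
    open CommutativeSemigroupProperties S.*-commutativeSemigroup using () renaming (x∙yz≈y∙xz to S-x∙yz≈y∙xz)
    b = egf K (delayedChoose m)
    I = ∫₀ᵗ integrand m dr
    rhs = eᵉˣ ⊛ ∫₀ K I
    D-lhs : D (egf K a) ≋ eˣ ⊛ egf K a ⊕ b
    D-lhs = begin
      D (egf K a)                                                    ≈⟨ D-egf a ⟩
      egf K (λ n → a (suc n))                                        ≈⟨ egf-cong rec ⟩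
      egf K (λ n → binomialTransform a n ℕ.+ delayedChoose m n)
        ≈⟨ egf-+ (binomialTransform a) (delayedChoose m) ⟨
      egf K (binomialTransform a) ⊕ b                                ≈⟨ S.+-congʳ {b} (eˣ-⊛-egf a) ⟨
      eˣ ⊛ egf K a ⊕ b                                               ∎
    D-rhs : D rhs ≋ eˣ ⊛ rhs ⊕ b
    D-rhs = begin
      D rhs                                          ≈⟨ D-⊛ eᵉˣ (∫₀ K I) ⟩
      D eᵉˣ ⊛ ∫₀ K I ⊕ eᵉˣ ⊛ D (∫₀ K I)            ≈⟨ S.+-cong (S.*-congʳ {∫₀ K I} D-eᵉˣ)
                                                        (S.*-congˡ {eᵉˣ} (S.trans (D-∫₀ I) (∫₀ᵗ-integrand m))) ⟩
      eˣ ⊛ eᵉˣ ⊛ ∫₀ K I ⊕ eᵉˣ ⊛ (b ⊛ e⁻ᵉˣ)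
        ≈⟨ S.+-cong (S.*-assoc eˣ eᵉˣ (∫₀ K I)) (S-x∙yz≈y∙xz eᵉˣ b e⁻ᵉˣ) ⟩
      eˣ ⊛ rhs ⊕ b ⊛ (eᵉˣ ⊛ e⁻ᵉˣ)
        ≈⟨ S.+-congˡ {eˣ ⊛ rhs} (S.*-congˡ {b} eᵉˣ-inverse) ⟩
      eˣ ⊛ rhs ⊕ b ⊛ S.1#                            ≈⟨ S.+-congˡ {eˣ ⊛ rhs} (S.*-identityʳ b) ⟩
      eˣ ⊛ rhs ⊕ b                                   ∎

  -- Subtracting 1 in the exponent leaves its derivative alone and normalises the initial value to
  -- exp 0 = 1, the count of the empty permutation.
  egf≋exp : ∀ a → a 0 ≡ 1 → (∀ n → a (suc n) ≡ binomialTransform a n) →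
            egf K a ≋ expSeries K (eˣ ⊕ S.- S.1#)
  egf≋exp a a₀ rec = homogeneousODE-unique eˣ D-lhs D-rhs
    (trans (reflexive (≡.cong (λ k → fromℚ (k /ℕ 1)) a₀)) (trans fromℚ-1
      (sym (trans (expSeries₀ f) (trans (exp-cong (trans (+-congʳ eˣ₀) (-‿inverseʳ 1#))) exp-0)))))
    where
    open ≋-Reasoning
    open RingProperties ring using (-0#≈0#)
    f = eˣ ⊕ S.- S.1#
    D-lhs : D (egf K a) ≋ eˣ ⊛ egf K a
    D-lhs = begin
      D (egf K a)                  ≈⟨ D-egf a ⟩
      egf K (λ n → a (suc n))      ≈⟨ egf-cong rec ⟩
      egf K (binomialTransform a)  ≈⟨ eˣ-⊛-egf a ⟨
      eˣ ⊛ egf K a                 ∎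
    Df : D f ≋ eˣ
    -- At positive indices `S.- S.1#` is `- 0#`, which still has to be simplified.
    Df n = trans (*-congˡ (trans (+-congˡ -0#≈0#) (+-identityʳ _))) (D-eˣ n)
    D-rhs : D (expSeries K f) ≋ eˣ ⊛ expSeries K f
    D-rhs = S.trans (D-exp f) (S.*-congʳ {expSeries K f} Df)

open ≡ using (refl)

-- Splitting a list into two complementary sublists

splits : List X → List (List X × List X)
splits []      = ([] , []) ∷ []
splits (y ∷ L) = map (map₂ (y ∷_)) (splits L) ++ map (map₁ (y ∷_)) (splits L)

-- Giving the first element to the right part keeps `a`; giving it to the left part shifts `a`.
-- These are the two summands of `binomialTransform`.
length-concatMap-splits : ∀ (a : ℕ → ℕ) (f : List X × List X → List Y) →
  (∀ S T → length (f (S , T)) ≡ a (length S)) →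
  ∀ L → length (concatMap f (splits L)) ≡ binomialTransform a (length L)
length-concatMap-splits a f len []      =
  ≡.trans (≡.cong length (List.++-identityʳ (f ([] , [])))) (len [] [])
length-concatMap-splits a f len (y ∷ L) = begin
  length (concatMap f (right ++ left))
    ≡⟨ ≡.cong length (List.concatMap-++ f right left) ⟩
  length (concatMap f right ++ concatMap f left)       ≡⟨ List.length-++ (concatMap f right) ⟩
  length (concatMap f right) ℕ.+ length (concatMap f left)
    ≡⟨ ≡.cong₂ (λ u v → length u ℕ.+ length v) (List.concatMap-map f _ (splits L)) (List.concatMap-map f _ (splits L)) ⟩
  length (concatMap (f ∘ map₂ (y ∷_)) (splits L)) ℕ.+ length (concatMap (f ∘ map₁ (y ∷_)) (splits L))
    ≡⟨ ≡.cong₂ ℕ._+_ (length-concatMap-splits a _ (λ S T → len S (y ∷ T)) L)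
                     (length-concatMap-splits (a ∘ suc) _ (λ S T → len (y ∷ S) T) L) ⟩
  binomialTransform a (suc (length L))                 ∎
  where
  open ≡.≡-Reasoning
  right = map (map₂ (y ∷_)) (splits L)
  left  = map (map₁ (y ∷_)) (splits L)

splits-sound : ∀ L {S T : List X} → (S , T) ∈ splits L → Interleaving S T L
splits-sound []      (here refl) = []
splits-sound (y ∷ L) p with ∈-++⁻ (map (map₂ (y ∷_)) (splits L)) p
... | inj₁ q with _ , q′ , refl ← ∈-map⁻ (map₂ (y ∷_)) q = consʳ (splits-sound L q′)
... | inj₂ q with _ , q′ , refl ← ∈-map⁻ (map₁ (y ∷_)) q = consˡ (splits-sound L q′)

splits-complete : ∀ {L S T : List X} → Interleaving S T L → (S , T) ∈ splits L
splits-complete []        = here refl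
splits-complete (consˡ i) = ∈-++⁺ʳ _ (∈-map⁺ (map₁ (_ ∷_)) (splits-complete i))
splits-complete (consʳ i) = ∈-++⁺ˡ (∈-map⁺ (map₂ (_ ∷_)) (splits-complete i))

interleaving-length : ∀ {L S T : List X} → Interleaving S T L → length S ≤ length L
interleaving-length []        = z≤n
interleaving-length (consˡ i) = s≤s (interleaving-length i)
interleaving-length (consʳ i) = ℕ.m≤n⇒m≤1+n (interleaving-length i)

++-interleaving : ∀ (xs ys : List X) → Interleaving xs ys (xs ++ ys)
++-interleaving []       []       = []
++-interleaving []       (y ∷ ys) = consʳ (++-interleaving [] ys)
++-interleaving (x ∷ xs) ys       = consˡ (++-interleaving xs ys)

All-interleaving : ∀ {P : X → Set} {L S T} → Interleaving S T L → All P L → All P S × All P T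
All-interleaving i = All.++⁻ _ ∘ All-resp-↭ (toPermutation i)

AllPairs-interleaving : ∀ {R : X → X → Set} {L S T} → Interleaving S T L →
  AllPairs R L → AllPairs R S × AllPairs R T
AllPairs-interleaving []        []       = [] , []
AllPairs-interleaving (consˡ i) (r ∷ rs) =
  map₁ (proj₁ (All-interleaving i r) ∷_) (AllPairs-interleaving i rs)
AllPairs-interleaving (consʳ i) (r ∷ rs) =
  map₂ (proj₂ (All-interleaving i r) ∷_) (AllPairs-interleaving i rs)

-- The splits (S , T) with |S| = m in which the last element lies in T.
splitsBeforeLast : ℕ → List X → List (List X × List X)
splitsBeforeLast m       []      = []
splitsBeforeLast zero    (y ∷ L) = ([] , y ∷ L) ∷ []
splitsBeforeLast (suc m) (y ∷ L) =
  map (map₁ (y ∷_)) (splitsBeforeLast m L) ++ map (map₂ (y ∷_)) (splitsBeforeLast (suc m) L)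

-- With the last element reserved for the right part, the m elements of the left part are chosen
-- among the others.
length-splitsBeforeLast : ∀ m (L : List X) → length (splitsBeforeLast m L) ≡ delayedChoose m (length L)
length-splitsBeforeLast m       []      = refl
length-splitsBeforeLast zero    (y ∷ L) = refl
length-splitsBeforeLast (suc m) (y ∷ L) = begin
  length (left ++ right)               ≡⟨ List.length-++ left ⟩
  length left ℕ.+ length right
    ≡⟨ ≡.cong₂ ℕ._+_ (List.length-map _ (splitsBeforeLast m L)) (List.length-map _ (splitsBeforeLast (suc m) L)) ⟩
  length (splitsBeforeLast m L) ℕ.+ length (splitsBeforeLast (suc m) L)
    ≡⟨ ≡.cong₂ ℕ._+_ (length-splitsBeforeLast m L) (length-splitsBeforeLast (suc m) L) ⟩
  delayedChoose m (length L) ℕ.+ delayedChoose (suc m) (length L) ≡⟨ pascal (length L) ⟩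
  choose (suc m) (length L)            ∎
  where
  open ≡.≡-Reasoning
  left  = map (map₁ (y ∷_)) (splitsBeforeLast m L)
  right = map (map₂ (y ∷_)) (splitsBeforeLast (suc m) L)
  pascal : ∀ n → delayedChoose m n ℕ.+ delayedChoose (suc m) n ≡ choose (suc m) n
  pascal zero    = refl
  pascal (suc n) = refl

-- Monotone lists

Increasing Decreasing : List (Fin N) → Set
Increasing = AllPairs Fin._<_
Decreasing = AllPairs Fin._>_

AllPairs-reverse : ∀ {R : X → X → Set} {xs} → AllPairs R xs → AllPairs (λ x y → R y x) (reverse xs)
AllPairs-reverse []                       = []
AllPairs-reverse {xs = x ∷ xs} (r ∷ rs) rewrite List.unfold-reverse x xs =
  AllPairs.++⁺ (AllPairs-reverse rs) ([] ∷ []) (All.map (_∷ []) (All-resp-↭ (↭-sym (↭-reverse xs)) r))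

-- Walking along `L` sorts σ into `S`: the smallest letter `y` lies either in σ or in `T`, and in
-- the latter case it must be the head, because `T` is increasing.
interleaving-of-↭ : ∀ {σ T L : List (Fin N)} → Increasing L → Increasing T → σ ++ T ↭ L →
                    ∃[ S ] σ ↭ S × Interleaving S T L
interleaving-of-↭ {σ = σ} {T} {[]} _ _ p
  with List.++-conicalˡ σ T (↭-empty-inv p) | List.++-conicalʳ σ T (↭-empty-inv p)
... | refl | refl = [] , ↭-refl , []
interleaving-of-↭ {σ = σ} {T} {y ∷ L} (y<L ∷ incL) incT p with ∈-++⁻ σ (∈-resp-↭ (↭-sym p) (here refl))
... | inj₁ y∈σ with σ₁ , σ₂ , refl ← ∈-∃++ y∈σ =
      let S , σ↭S , i = interleaving-of-↭ incL incT
            (≡.subst (_↭ L) (≡.sym (List.++-assoc σ₁ σ₂ T))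
              (drop-mid σ₁ [] (≡.subst (_↭ y ∷ L) (List.++-assoc σ₁ (y ∷ σ₂) T) p)))
      in y ∷ S , ↭-trans (↭-shift y σ₁ σ₂) (↭-prep y σ↭S) , consˡ i
... | inj₂ y∈T with T | incT | y∈T
...   | .y ∷ T′ | _ ∷ incT′  | here refl   =
      let S , σ↭S , i = interleaving-of-↭ incL incT′ (drop-mid σ [] p)
      in S , σ↭S , consʳ i
...   | z ∷ T′  | z<T′ ∷ _ | there y∈T′ with ∈-resp-↭ p (∈-++⁺ʳ σ (here refl))
...     | here refl = ⊥-elim (Fin.<-irrefl refl (All.lookup z<T′ y∈T′))
...     | there z∈L = ⊥-elim (Fin.<-asym (All.lookup z<T′ y∈T′) (All.lookup y<L z∈L))

increasing-↭⇒≡ : ∀ {xs ys : List (Fin N)} → Increasing xs → Increasing ys → xs ↭ ys → xs ≡ ys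
increasing-↭⇒≡ {xs = xs} {[]} _ _ p = ↭-empty-inv p
increasing-↭⇒≡ {xs = []} {_ ∷ _} _ _ p with () ← ↭-empty-inv (↭-sym p)
increasing-↭⇒≡ {xs = x ∷ xs} {y ∷ ys} (x<xs ∷ incx) (y<ys ∷ incy) p
  with ∈-resp-↭ p (here refl) | ∈-resp-↭ (↭-sym p) (here refl)
... | here refl  | _          = ≡.cong (x ∷_) (increasing-↭⇒≡ incx incy (drop-∷ p))
... | there _    | here refl  = ≡.cong (x ∷_) (increasing-↭⇒≡ incx incy (drop-∷ p))
... | there x∈ys | there y∈xs = ⊥-elim (Fin.<-asym (All.lookup x<xs y∈xs) (All.lookup y<ys x∈ys))

-- For increasing `T` the letter `e` is its maximum, so the largest letter of all falls to `T`. The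
-- condition is phrased by `reverse T` because that is the block that follows x in the word.
LastAbove : List (Fin N) → List (Fin N) → Set
LastAbove S T = ∃[ e ] ∃[ τ ] reverse T ≡ e ∷ τ × All (Fin._< e) S

splitsBeforeLast-sound : ∀ m {L S T : List (Fin N)} → Increasing L → (S , T) ∈ splitsBeforeLast m L →
                         Interleaving S T L × length S ≡ m × LastAbove S T
splitsBeforeLast-sound zero {y ∷ L} inc (here refl) =
  splits-sound (y ∷ L) (here-right (y ∷ L)) , refl , nonEmpty
  where
  here-right : ∀ (L : List (Fin N)) → ([] , L) ∈ splits L
  here-right []      = here refl
  here-right (y ∷ L) = ∈-++⁺ˡ (∈-map⁺ (map₂ (y ∷_)) (here-right L))
  nonEmpty : LastAbove [] (y ∷ L)
  nonEmpty with reverse (y ∷ L) in eq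
  ... | []    with () ← ≡.trans (≡.sym (List.length-reverse (y ∷ L))) (≡.cong length eq)
  ... | e ∷ τ = e , τ , refl , []
splitsBeforeLast-sound (suc m) {y ∷ L} (y<L ∷ inc) p with ∈-++⁻ (map (map₁ (y ∷_)) (splitsBeforeLast m L)) p
... | inj₁ q with (S , T) , q′ , refl ← ∈-map⁻ (map₁ (y ∷_)) q =
      let i , len , e , τ , eq , S<e = splitsBeforeLast-sound m inc q′
          y<revT = All-resp-↭ (↭-sym (↭-reverse T)) (proj₂ (All-interleaving i y<L))
      in consˡ i , ≡.cong suc len , e , τ , eq , All.head (≡.subst (All (y Fin.<_)) eq y<revT) ∷ S<e
... | inj₂ q with (S , T) , q′ , refl ← ∈-map⁻ (map₂ (y ∷_)) q =
      let i , len , e , τ , eq , S<e = splitsBeforeLast-sound (suc m) inc q′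
      in consʳ i , len , e , τ ++ [ y ] , ≡.trans (List.unfold-reverse y T) (≡.cong (_++ [ y ]) eq) , S<e

splitsBeforeLast-complete : ∀ m {L S T : List (Fin N)} → Increasing L → Interleaving S T L →
                            length S ≡ m → LastAbove S T → (S , T) ∈ splitsBeforeLast m L
splitsBeforeLast-complete m       {[]}    inc [] len (e , τ , () , _)
splitsBeforeLast-complete (suc m) {y ∷ L} (y<L ∷ inc) (consˡ i) len (e , τ , eq , _ ∷ S<e) =
  ∈-++⁺ˡ (∈-map⁺ (map₁ (y ∷_)) (splitsBeforeLast-complete m inc i (ℕ.suc-injective len) (e , τ , eq , S<e)))
splitsBeforeLast-complete zero    {y ∷ L} {[]} {.y ∷ T} (y<L ∷ inc) (consʳ i) len _ =
  here (≡.cong (λ z → [] , y ∷ z) (unsplit i))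
  where
  unsplit : ∀ {T L : List (Fin N)} → Interleaving [] T L → T ≡ L
  unsplit []        = refl
  unsplit (consʳ i) = ≡.cong (_ ∷_) (unsplit i)
splitsBeforeLast-complete (suc m) {y ∷ L} {s ∷ S} {.y ∷ T} (y<L ∷ inc) (consʳ i) len (e , τ , eq , s<e ∷ S<e)
  with reverse T in revT | ≡.trans (≡.sym (List.unfold-reverse y T)) eq
-- Here `T` is empty beyond `y`, so `e` is `y`; but `y` heads an increasing list and lies below `s`.
... | []     | refl = ⊥-elim (Fin.<-asym s<e (All.head (proj₁ (All-interleaving i y<L))))
... | e′ ∷ τ′ | refl = ∈-++⁺ʳ _ (∈-map⁺ (map₂ (y ∷_))
      (splitsBeforeLast-complete (suc m) inc i len (e , τ′ , revT , s<e ∷ S<e)))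

-- Words avoiding 1-23 and their beginnings

-- `Linked` tests neighbours only, which expresses that 2 and 3 of the pattern 1-23 are adjacent;
-- the recursion in `Avoids` lets the 1 stand anywhere before them.
NoAscentAbove : Fin N → List (Fin N) → Set
NoAscentAbove a = Linked λ b c → ¬ (a Fin.< b × b Fin.< c)

Avoids : List (Fin N) → Set
Avoids []      = ⊤
Avoids (a ∷ w) = NoAscentAbove a w × Avoids w

-- The pattern is (k-1)(k-2)⋯1k for k = p + 1; by the convention on the empty
-- permutation, p = 0 imposes no condition.
Begins : ℕ → List (Fin N) → Set
Begins zero    w = ⊤
Begins (suc m) w = ∃[ d ] ∃[ e ] ∃[ rest ]
  w ≡ d ++ e ∷ rest × length d ≡ suc m × Decreasing d × All (Fin._< e) d

Linked-++⁻ˡ : ∀ {R : X → X → Set} xs {ys} → Linked R (xs ++ ys) → Linked R xs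
Linked-++⁻ˡ []           _        = []
Linked-++⁻ˡ (x ∷ [])     _        = [-]
Linked-++⁻ˡ (x ∷ y ∷ xs) (r ∷ rs) = r ∷ Linked-++⁻ˡ (y ∷ xs) rs

Avoids-++⁻ˡ : ∀ (σ : List (Fin N)) {τ} → Avoids (σ ++ τ) → Avoids σ
Avoids-++⁻ˡ []      _         = tt
Avoids-++⁻ˡ (a ∷ σ) (na , av) = Linked-++⁻ˡ σ na , Avoids-++⁻ˡ σ av

Avoids-++⁻ʳ : ∀ (σ : List (Fin N)) {τ} → Avoids (σ ++ τ) → Avoids τ
Avoids-++⁻ʳ []      av       = av
Avoids-++⁻ʳ (a ∷ σ) (_ , av) = Avoids-++⁻ʳ σ av

-- An ascent in τ would form 1-23 together with `x`, which lies below all of τ.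
NoAscentAbove⇒Decreasing : ∀ {x : Fin N} {τ} → All (x Fin.<_) τ → Unique τ →
                           NoAscentAbove x τ → Decreasing τ
NoAscentAbove⇒Decreasing x<τ uniq na =
  Linked.Linked⇒AllPairs (λ p q → Fin.<-trans q p) (descents x<τ uniq na)
  where
  descents : ∀ {x : Fin N} {τ} → All (x Fin.<_) τ → Unique τ → NoAscentAbove x τ → Linked Fin._>_ τ
  descents {τ = []}        _          _              _          = []
  descents {τ = _ ∷ []}    _          _              _          = [-]
  descents {τ = b ∷ c ∷ _} (x<b ∷ x<τ) ((b≢c ∷ _) ∷ uniq) (na ∷ nas) =
    Fin.≤∧≢⇒< (ℕ.≮⇒≥ (λ b<c → na (x<b , b<c))) (b≢c ∘ ≡.sym) ∷ descents x<τ uniq nas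

Decreasing⇒NoAscentAbove : ∀ {a : Fin N} {τ} → Decreasing τ → NoAscentAbove a τ
Decreasing⇒NoAscentAbove dec =
  Linked.map (λ c<b → λ (_ , b<c) → Fin.<-asym b<c c<b) (Linked.AllPairs⇒Linked dec)

Decreasing⇒Avoids : ∀ {τ : List (Fin N)} → Decreasing τ → Avoids τ
Decreasing⇒Avoids []        = tt
Decreasing⇒Avoids (_ ∷ dec) = Decreasing⇒NoAscentAbove dec , Decreasing⇒Avoids dec

-- The least letter `x` cannot be the 2 or the 3 of an occurrence, and every ascent needed after it
-- is missing from the decreasing τ.
Avoids-++⁺ : ∀ {x : Fin N} {σ τ} → All (x Fin.<_) σ → Decreasing τ → Avoids σ → Avoids (σ ++ x ∷ τ)
Avoids-++⁺ {σ = []}        _           dec _         = Decreasing⇒NoAscentAbove dec , Decreasing⇒Avoids dec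
Avoids-++⁺ {x = x} {a ∷ σ} (x<a ∷ x<σ) dec (na , av) = join x<σ na , Avoids-++⁺ x<σ dec av
  where
  fromMin : ∀ {τ} → Decreasing τ → NoAscentAbove a (x ∷ τ)
  fromMin []          = [-]
  fromMin (dec@(_ ∷ _)) = (λ (a<x , _) → Fin.<-asym a<x x<a) ∷ Decreasing⇒NoAscentAbove dec
  join : ∀ {σ} → All (x Fin.<_) σ → NoAscentAbove a σ → NoAscentAbove a (σ ++ x ∷ _)
  join {[]}        _         _          = fromMin dec
  join {_ ∷ []}    (x<b ∷ _) _          = (λ (_ , b<x) → Fin.<-asym b<x x<b) ∷ fromMin dec
  join {_ ∷ _ ∷ _} (_ ∷ x<σ) (na ∷ nas) = na ∷ join x<σ nas

Begins-++⁺ : ∀ p {σ : List (Fin N)} {τ} → Begins p σ → Begins p (σ ++ τ)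
Begins-++⁺ zero    _ = tt
Begins-++⁺ (suc m) {τ = τ} (d , e , rest , refl , p) = d , e , rest ++ τ , List.++-assoc d (e ∷ rest) τ , p

++-∷-compare : ∀ (d σ : List X) {e x r τ} → d ++ e ∷ r ≡ σ ++ x ∷ τ →
  (∃[ σ′ ] σ ≡ d ++ e ∷ σ′) ⊎ (d ≡ σ × e ≡ x) ⊎ (∃[ d′ ] d ≡ σ ++ x ∷ d′ × τ ≡ d′ ++ e ∷ r)
++-∷-compare []      []      refl = inj₂ (inj₁ (refl , refl))
++-∷-compare []      (s ∷ σ) refl = inj₁ (σ , refl)
++-∷-compare (a ∷ d) []      refl = inj₂ (inj₂ (d , refl , refl))
++-∷-compare (a ∷ d) (s ∷ σ) eq with refl , eq′ ← List.∷-injective eq with ++-∷-compare d σ eq′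
... | inj₁ (σ′ , refl)               = inj₁ (σ′ , refl)
... | inj₂ (inj₁ (refl , refl))      = inj₂ (inj₁ (refl , refl))
... | inj₂ (inj₂ (d′ , refl , refl)) = inj₂ (inj₂ (d′ , refl , refl))

-- The straddling case with m = k-2: σ plays k-1, ..., 2, the least letter x plays 1, and the first
-- letter `e` of τ plays k.
EndsPattern : ℕ → List (Fin N) → List (Fin N) → Set
EndsPattern m σ τ = length σ ≡ m × Decreasing σ × (∃[ e ] ∃[ τ′ ] τ ≡ e ∷ τ′ × All (Fin._< e) σ)

-- Locate the top letter `e` of the pattern. It is not `x`, since the nonempty `d` lies below `e`
-- and above the least letter. If it lies in τ, then `x` belongs to the decreasing `d` and must be
-- its last letter.
Begins-split : ∀ m {σ : List (Fin N)} {x τ} → All (x Fin.<_) σ → All (x Fin.<_) τ →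
  Begins (suc m) (σ ++ x ∷ τ) → Begins (suc m) σ ⊎ EndsPattern m σ τ
Begins-split m {σ} {x} x<σ x<τ (d , e , rest , eq , len , dec , d<e) with ++-∷-compare d σ (≡.sym eq)
... | inj₁ (σ′ , eq′)               = inj₁ (d , e , σ′ , eq′ , len , dec , d<e)
... | inj₂ (inj₁ (refl , refl))      = ⊥-elim (notLast len x<σ d<e)
  where
  notLast : ∀ {d} → length d ≡ suc m → All (x Fin.<_) d → All (Fin._< x) d → _
  notLast {_ ∷ _} _ (x<a ∷ _) (a<x ∷ _) = Fin.<-asym x<a a<x
... | inj₂ (inj₂ (d′ , refl , refl)) = inj₂ (straddle d′ x<τ len dec d<e)
  where
  straddle : ∀ d′ → All (x Fin.<_) (d′ ++ e ∷ rest) → length (σ ++ x ∷ d′) ≡ suc m →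
            Decreasing (σ ++ x ∷ d′) → All (Fin._< e) (σ ++ x ∷ d′) → EndsPattern m σ (d′ ++ e ∷ rest)
  straddle d′@(b ∷ _) (x<b ∷ _) _ dec _ with (b<x ∷ _) ∷ _ ← proj₂ (AllPairs-interleaving (++-interleaving σ (x ∷ d′)) dec) =
    ⊥-elim (Fin.<-asym x<b b<x)
  straddle [] _ len dec σ<e =
      ℕ.suc-injective (≡.trans (≡.sym (≡.trans (List.length-++ σ) (ℕ.+-comm (length σ) 1))) len)
    , proj₁ (AllPairs-interleaving (++-interleaving σ [ x ]) dec)
    , e , rest , refl , All.++⁻ˡ σ σ<e

Begins-cases : ∀ p {σ : List (Fin N)} {x τ} → All (x Fin.<_) σ → All (x Fin.<_) τ →
  Begins p (σ ++ x ∷ τ) → Begins p σ ⊎ (∃[ m ] p ≡ suc m × EndsPattern m σ τ)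
Begins-cases zero    _   _   _  = inj₁ tt
Begins-cases (suc m) x<σ x<τ be with Begins-split m x<σ x<τ be
... | inj₁ beσ  = inj₁ beσ
... | inj₂ ends = inj₂ (m , refl , ends)

Begins-join : ∀ m {σ : List (Fin N)} {x τ} → All (x Fin.<_) σ → All (x Fin.<_) τ →
  EndsPattern m σ τ → Begins (suc m) (σ ++ x ∷ τ)
Begins-join m {σ} {x} x<σ (x<e ∷ _) (len , dec , e , τ′ , refl , σ<e) =
    σ ++ [ x ] , e , τ′ , ≡.sym (List.++-assoc σ [ x ] (e ∷ τ′))
  , ≡.trans (List.length-++ σ) (≡.trans (ℕ.+-comm (length σ) 1) (≡.cong suc len))
  , AllPairs.++⁺ dec ([] ∷ []) (All.map (_∷ []) x<σ) , All.++⁺ σ<e (x<e ∷ [])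

Begins⇒length> : ∀ m {w : List (Fin N)} → Begins (suc m) w → suc m ℕ.< length w
Begins⇒length> m (d , e , rest , refl , len , _) =
  ≡.subst₂ ℕ._<_ len (≡.sym (List.length-++ d)) (ℕ.m<m+n (length d) (s≤s z≤n))

-- Recursive enumeration of the avoiders that begin with the pattern

emptyWord : ℕ → List (List X)
emptyWord zero    = [] ∷ []
emptyWord (suc m) = []

-- For `p = 0` there is no straddling case: every word begins with the pattern, so its σ does as
-- well.
patternSplits : ℕ → List X → List (List X × List X)
patternSplits zero    L = []
patternSplits (suc m) L = splitsBeforeLast m L

-- The first argument is fuel; the enumeration is complete once it reaches the
-- length of L.
avoiders : ℕ → ℕ → List X → List (List X)
avoiders f       p []      = emptyWord p
avoiders zero    p (x ∷ L) = []
avoiders (suc f) p (x ∷ L) =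
  concatMap (λ (S , T) → map (λ σ → σ ++ x ∷ reverse T) (avoiders f p S)) (splits L) ++
  map (λ (S , T) → reverse S ++ x ∷ reverse T) (patternSplits p L)

patternCount : ℕ → ℕ → ℕ
patternCount zero    n = 0
patternCount (suc m) n = delayedChoose m n

-- `binomialTransform` receives the whole sequence, which hides that it reads only lengths up to
-- `n`; hence fuel here as in `avoiders`.
avoiderCount : ℕ → ℕ → ℕ → ℕ
avoiderCount f       p zero    = length (emptyWord {⊤} p)
avoiderCount zero    p (suc n) = 0
avoiderCount (suc f) p (suc n) = binomialTransform (avoiderCount f p) n ℕ.+ patternCount p n

length-patternSplits : ∀ p (L : List X) → length (patternSplits p L) ≡ patternCount p (length L)
length-patternSplits zero    L = refl
length-patternSplits (suc m) L = length-splitsBeforeLast m L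

length-avoiders : ∀ f p (L : List X) → length (avoiders f p L) ≡ avoiderCount f p (length L)
length-avoiders zero    zero    []      = refl
length-avoiders zero    (suc p) []      = refl
length-avoiders (suc f) zero    []      = refl
length-avoiders (suc f) (suc p) []      = refl
length-avoiders zero    p       (x ∷ L) = refl
length-avoiders (suc f) p       (x ∷ L) = begin
  length (earlier ++ straddling)                       ≡⟨ List.length-++ earlier ⟩
  length earlier ℕ.+ length straddling                 ≡⟨ ≡.cong₂ ℕ._+_
    (length-concatMap-splits (avoiderCount f p) _
      (λ S T → ≡.trans (List.length-map _ (avoiders f p S)) (length-avoiders f p S)) L)
    (≡.trans (List.length-map _ (patternSplits p L)) (length-patternSplits p L)) ⟩
  avoiderCount (suc f) p (suc (length L))              ∎
  where
  open ≡.≡-Reasoning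
  earlier    = concatMap (λ (S , T) → map (λ σ → σ ++ x ∷ reverse T) (avoiders f p S)) (splits L)
  straddling = map (λ (S , T) → reverse S ++ x ∷ reverse T) (patternSplits p L)

binomialTransform-cong : ∀ {a b} n → (∀ i → i ≤ n → a i ≡ b i) → binomialTransform a n ≡ binomialTransform b n
binomialTransform-cong zero    eq = eq 0 z≤n
binomialTransform-cong (suc n) eq = ≡.cong₂ ℕ._+_
  (binomialTransform-cong n (λ i i≤n → eq i (ℕ.m≤n⇒m≤1+n i≤n)))
  (binomialTransform-cong n (λ i i≤n → eq (suc i) (s≤s i≤n)))

avoiderCount-fuel : ∀ {f g} p {n} → n ≤ f → n ≤ g → avoiderCount f p n ≡ avoiderCount g p n
avoiderCount-fuel {zero}  {zero}  p {zero}  _         _         = refl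
avoiderCount-fuel {zero}  {suc g} p {zero}  _         _         = refl
avoiderCount-fuel {suc f} {zero}  p {zero}  _         _         = refl
avoiderCount-fuel {suc f} {suc g} p {zero}  _         _         = refl
avoiderCount-fuel {suc f} {suc g} p {suc n} (s≤s n≤f) (s≤s n≤g) = ≡.cong (ℕ._+ patternCount p n)
  (binomialTransform-cong n λ i i≤n → avoiderCount-fuel {f} {g} p (ℕ.≤-trans i≤n n≤f) (ℕ.≤-trans i≤n n≤g))

avoiderCount-suc : ∀ p n → avoiderCount (suc n) p (suc n) ≡
  binomialTransform (λ i → avoiderCount i p i) n ℕ.+ patternCount p n
avoiderCount-suc p n = ≡.cong (ℕ._+ patternCount p n)
  (binomialTransform-cong n λ i i≤n → avoiderCount-fuel {n} {i} p i≤n ℕ.≤-refl)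

Valid : ℕ → List (Fin N) → List (Fin N) → Set
Valid p L w = w ↭ L × Avoids w × Begins p w

patternSplits-sound : ∀ p {L S T : List (Fin N)} → Increasing L → (S , T) ∈ patternSplits p L → Interleaving S T L
patternSplits-sound (suc m) inc q = proj₁ (splitsBeforeLast-sound m inc q)

word-↭ : ∀ {L S T σ : List X} {x} → Interleaving S T L → σ ↭ S → σ ++ x ∷ reverse T ↭ x ∷ L
word-↭ {L = L} {S} {T} {σ} {x} i σ↭S = begin
  σ ++ x ∷ reverse T     ↭⟨ ↭-shift x σ (reverse T) ⟩
  x ∷ σ ++ reverse T     ↭⟨ ↭-prep x (++⁺ σ↭S (↭-reverse T)) ⟩
  x ∷ S ++ T             ↭⟨ ↭-prep x (toPermutation i) ⟨
  x ∷ L                  ∎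
  where open PermutationReasoning

All-reverse : ∀ {P : X → Set} {xs} → All P xs → All P (reverse xs)
All-reverse {xs = xs} = All-resp-↭ (↭-sym (↭-reverse xs))

avoiders-sound : ∀ f p {L : List (Fin N)} {w} → Increasing L → w ∈ avoiders f p L → Valid p L w
avoiders-sound zero    zero {[]} inc (here refl) = ↭-refl , tt , tt
avoiders-sound (suc f) zero {[]} inc (here refl) = ↭-refl , tt , tt
avoiders-sound (suc f) p {x ∷ L} (x<L ∷ inc) w∈
  with ∈-++⁻ (concatMap (λ (S , T) → map (λ σ → σ ++ x ∷ reverse T) (avoiders f p S)) (splits L)) w∈
... | inj₁ w∈earlier
  with (S , T) , ST∈ , w∈map ← find (∈-concatMap⁻ (λ (S , T) → map (λ σ → σ ++ x ∷ reverse T) (avoiders f p S)) {xs = splits L} w∈earlier)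
  with σ , σ∈ , refl ← ∈-map⁻ (λ σ → σ ++ x ∷ reverse T) w∈map =
    let i             = splits-sound L ST∈
        incS , incT   = AllPairs-interleaving i inc
        x<S , x<T     = All-interleaving i x<L
        σ↭S , av , be = avoiders-sound f p incS σ∈
    in word-↭ i σ↭S
     , Avoids-++⁺ (All-resp-↭ (↭-sym σ↭S) x<S) (AllPairs-reverse incT) av
     , Begins-++⁺ p be
avoiders-sound (suc f) (suc m) {x ∷ L} (x<L ∷ inc) w∈ | inj₂ w∈straddling
  with (S , T) , ST∈ , refl ← ∈-map⁻ (λ (S , T) → reverse S ++ x ∷ reverse T) w∈straddling =
    let i , len , e , τ , eq , S<e = splitsBeforeLast-sound m inc ST∈
        incS , incT                = AllPairs-interleaving i inc
        x<S , x<T                  = All-interleaving i x<L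
    in word-↭ i (↭-reverse S)
     , Avoids-++⁺ (All-reverse x<S) (AllPairs-reverse incT) (Decreasing⇒Avoids (AllPairs-reverse incS))
     , Begins-join m (All-reverse x<S) (All-reverse x<T)
         (≡.trans (List.length-reverse S) len , AllPairs-reverse incS , e , τ , eq , All-reverse S<e)

Unique-resp-↭ : ∀ {xs ys : List X} → xs ↭ ys → Unique xs → Unique ys
Unique-resp-↭ {X = X} = Setoid↭.Unique-resp-↭ (≡.setoid X) ∘ ↭⇒↭ₛ

-- Cutting the word at its least letter recovers the split: τ is decreasing, so `T` is τ reversed,
-- and `S` is σ sorted.
avoiders-complete : ∀ f p {L : List (Fin N)} {w} → Increasing L → length L ≤ f → Valid p L w → w ∈ avoiders f p L
avoiders-complete f p {[]} _ _ (w↭[] , _ , be) with refl ← ↭-empty-inv w↭[] = start f p be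
  where
  start : ∀ {N} f p → Begins {N} p [] → [] ∈ avoiders {Fin N} f p []
  start zero    zero    _ = here refl
  start (suc f) zero    _ = here refl
  start f       (suc m) be with () ← Begins⇒length> m be
avoiders-complete (suc f) p {x ∷ L} (x<L ∷ inc) (s≤s len≤f) (w↭ , av , be)
  with σ , τ , refl ← ∈-∃++ (∈-resp-↭ (↭-sym w↭) (here refl)) = assemble
  where
  στ↭L : σ ++ τ ↭ L
  στ↭L = drop-mid σ [] w↭
  x<σ,τ = All.++⁻ σ (All-resp-↭ (↭-sym στ↭L) x<L)
  x<σ = proj₁ x<σ,τ
  x<τ = proj₂ x<σ,τ
  uniqueτ : Unique τ
  uniqueτ =
    proj₂ (AllPairs-interleaving {R = _≢_} (++-interleaving σ τ) (Unique-resp-↭ (↭-sym στ↭L) (AllPairs.map Fin.<⇒≢ inc)))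
  decτ : Decreasing τ
  decτ = NoAscentAbove⇒Decreasing x<τ uniqueτ (proj₁ (Avoids-++⁻ʳ σ av))
  T = reverse τ
  incT : Increasing T
  incT = AllPairs-reverse decτ
  σT↭L : σ ++ T ↭ L
  σT↭L = ↭-trans (++⁺ ↭-refl (↭-reverse τ)) στ↭L
  S = proj₁ (interleaving-of-↭ inc incT σT↭L)
  σ↭S = proj₁ (proj₂ (interleaving-of-↭ inc incT σT↭L))
  i = proj₂ (proj₂ (interleaving-of-↭ inc incT σT↭L))
  incS = proj₁ (AllPairs-interleaving i inc)

  σ-avoider : Begins p σ → (σ ++ x ∷ τ) ∈ avoiders (suc f) p (x ∷ L)
  σ-avoider beσ = ∈-++⁺ˡ (∈-concatMap⁺ _ (lose (splits-complete i)
    (≡.subst (λ z → (σ ++ x ∷ z) ∈ map (λ σ → σ ++ x ∷ reverse T) (avoiders f p S)) (List.reverse-involutive τ)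
      (∈-map⁺ (λ σ → σ ++ x ∷ reverse T)
        (avoiders-complete f p incS (ℕ.≤-trans (interleaving-length i) len≤f)
          (σ↭S , Avoids-++⁻ˡ σ av , beσ))))))

  σ-decreasing : ∀ m → p ≡ suc m → EndsPattern m σ τ → (σ ++ x ∷ τ) ∈ avoiders (suc f) p (x ∷ L)
  σ-decreasing m p≡ (len , decσ , e , τ′ , τ≡ , σ<e) =
    ≡.subst (λ q → (σ ++ x ∷ τ) ∈ avoiders (suc f) q (x ∷ L)) (≡.sym p≡)
      (∈-++⁺ʳ _ (≡.subst₂ (λ u v → (u ++ x ∷ v) ∈ _) (≡.trans (≡.cong reverse (≡.sym revσ≡S)) (List.reverse-involutive σ)) (List.reverse-involutive τ)
        (∈-map⁺ (λ (S , T) → reverse S ++ x ∷ reverse T)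
          (splitsBeforeLast-complete m inc i (≡.trans (↭-length (↭-sym σ↭S)) len)
            (e , τ′ , ≡.trans (List.reverse-involutive τ) τ≡ , All-resp-↭ σ↭S σ<e)))))
    where
    revσ≡S : reverse σ ≡ S
    revσ≡S = increasing-↭⇒≡ (AllPairs-reverse decσ) incS (↭-trans (↭-reverse σ) σ↭S)

  assemble : (σ ++ x ∷ τ) ∈ avoiders (suc f) p (x ∷ L)
  assemble with Begins-cases p x<σ x<τ be
  ... | inj₁ beσ             = σ-avoider beσ
  ... | inj₂ (m , p≡ , ends) = σ-decreasing m p≡ ends

-- Absence of repetitions from the enumeration

split-injective : ∀ {x : X} σ σ′ {τ τ′} → x ∉ σ → x ∉ σ′ → σ ++ x ∷ τ ≡ σ′ ++ x ∷ τ′ → σ ≡ σ′ × τ ≡ τ′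
split-injective []      []       _   _    refl = refl , refl
split-injective []      (_ ∷ _)  _   x∉σ′ refl = ⊥-elim (x∉σ′ (here refl))
split-injective (_ ∷ _) []       x∉σ _    refl = ⊥-elim (x∉σ (here refl))
split-injective (s ∷ σ) (t ∷ σ′) x∉σ x∉σ′ eq with refl , eq′ ← List.∷-injective eq =
  map₁ (≡.cong (s ∷_)) (split-injective σ σ′ (x∉σ ∘ there) (x∉σ′ ∘ there) eq′)

-- A word shows `T` directly, as the reversed block after x, but `S` only up to the order of σ.
-- Hence splits are compared by their right parts.
RightPartsDistinct : List (List X × List X) → Set
RightPartsDistinct = AllPairs (_≢_ on proj₂)

splits-distinct : ∀ {L : List X} → Unique L → RightPartsDistinct (splits L)
splits-distinct []                          = [] ∷ []
splits-distinct {L = y ∷ L} (y∉L ∷ uniq) = AllPairs.++⁺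
  (AllPairs.map⁺ (AllPairs.map (λ T≢T′ → T≢T′ ∘ List.∷-injectiveʳ) (splits-distinct uniq)))
  (AllPairs.map⁺ (splits-distinct uniq))
  (All.map⁺ (All.tabulate λ _ → All.map⁺ (All.tabulate λ ST∈ →
    λ eq → Unique.Unique[x∷xs]⇒x∉xs (y∉L ∷ uniq)
      (∈-resp-↭ (↭-sym (toPermutation (splits-sound L ST∈))) (∈-++⁺ʳ _ (≡.subst (y ∈_) eq (here refl)))))))

splitsBeforeLast-distinct : ∀ m {L : List (Fin N)} → Increasing L → RightPartsDistinct (splitsBeforeLast m L)
splitsBeforeLast-distinct m       {[]}    _           = []
splitsBeforeLast-distinct zero    {y ∷ L} _           = [] ∷ []
splitsBeforeLast-distinct (suc m) {y ∷ L} (y<L ∷ inc) = AllPairs.++⁺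
  (AllPairs.map⁺ (splitsBeforeLast-distinct m inc))
  (AllPairs.map⁺ (AllPairs.map (λ T≢T′ → T≢T′ ∘ List.∷-injectiveʳ) (splitsBeforeLast-distinct (suc m) inc)))
  (All.map⁺ (All.tabulate λ ST∈ → All.map⁺ (All.tabulate λ _ →
    λ eq → Fin.<-irrefl refl (All.lookup y<L
      (∈-resp-↭ (↭-sym (toPermutation (proj₁ (splitsBeforeLast-sound m inc ST∈)))) (∈-++⁺ʳ _ (≡.subst (y ∈_) (≡.sym eq) (here refl))))))))

-- In a straddling word only `m` letters precede x, too few for the whole pattern. This keeps the
-- two families of `avoiders` apart.
patternSplits-¬Begins : ∀ p {L S T : List (Fin N)} → Increasing L → (S , T) ∈ patternSplits p L →
                        ¬ Begins p (reverse S)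
patternSplits-¬Begins (suc m) {S = S} inc ST∈ be = ℕ.<-irrefl
  (≡.sym (≡.trans (List.length-reverse S) (proj₁ (proj₂ (splitsBeforeLast-sound m inc ST∈)))))
  (ℕ.<-trans (ℕ.n<1+n m) (Begins⇒length> m be))

patternSplits-distinct : ∀ p {L : List (Fin N)} → Increasing L → RightPartsDistinct (patternSplits p L)
patternSplits-distinct zero    _   = []
patternSplits-distinct (suc m) inc = splitsBeforeLast-distinct m inc

AllPairs-∈ : ∀ {R Q : X → X → Set} {xs} → (∀ {x y} → x ∈ xs → y ∈ xs → R x y → Q x y) →
             AllPairs R xs → AllPairs Q xs
AllPairs-∈ f []       = []
AllPairs-∈ f (r ∷ rs) =
  All.tabulate (λ y∈ → f (here refl) (there y∈) (All.lookup r y∈)) ∷ AllPairs-∈ (λ x∈ y∈ → f (there x∈) (there y∈)) rs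

-- The letter x does not occur in σ, so the word determines both blocks around it. Different splits
-- give different second blocks, and for one split σ can be cancelled out.
avoiders-unique : ∀ f p {L : List (Fin N)} → Increasing L → Unique (avoiders f p L)
avoiders-unique zero    zero    {[]}    _ = [] ∷ []
avoiders-unique zero    (suc _) {[]}    _ = []
avoiders-unique (suc _) zero    {[]}    _ = [] ∷ []
avoiders-unique (suc _) (suc _) {[]}    _ = []
avoiders-unique zero    p       {x ∷ L} _ = []
avoiders-unique (suc f) p       {x ∷ L} (x<L ∷ inc) = Unique.++⁺
  (Unique.concat⁺
    (All.map⁺ (All.tabulate λ ST∈ → Unique.map⁺ (List.++-cancelʳ _ _ _)
      (avoiders-unique f p (proj₁ (AllPairs-interleaving (splits-sound L ST∈) inc)))))
    (AllPairs.map⁺ (AllPairs-∈ earlier-disjoint (splits-distinct (AllPairs.map Fin.<⇒≢ inc)))))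
  (AllPairs.map⁺ (AllPairs-∈ straddling-distinct (patternSplits-distinct p inc)))
  earlier-straddling
  where
  earlier : List (Fin _) × List (Fin _) → List (List (Fin _))
  earlier (S , T) = map (λ σ → σ ++ x ∷ reverse T) (avoiders f p S)
  straddling : List (Fin _) × List (Fin _) → List (Fin _)
  straddling (S , T) = reverse S ++ x ∷ reverse T

  x∉ : ∀ {S T σ} → Interleaving S T L → σ ↭ S → x ∉ σ
  x∉ i σ↭S x∈σ = Fin.<-irrefl refl (All.lookup (proj₁ (All-interleaving i x<L)) (∈-resp-↭ σ↭S x∈σ))

  x∉earlier : ∀ {S T σ} → (S , T) ∈ splits L → σ ∈ avoiders f p S → x ∉ σ
  x∉earlier ST∈ σ∈ = x∉ i (proj₁ (avoiders-sound f p (proj₁ (AllPairs-interleaving i inc)) σ∈))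
    where i = splits-sound L ST∈

  x∉straddling : ∀ {S T} → (S , T) ∈ patternSplits p L → x ∉ reverse S
  x∉straddling {S} ST∈ = x∉ (patternSplits-sound p inc ST∈) (↭-reverse S)

  earlier-disjoint : ∀ {ST ST′} → ST ∈ splits L → ST′ ∈ splits L → proj₂ ST ≢ proj₂ ST′ →
                     Disjoint (earlier ST) (earlier ST′)
  earlier-disjoint {_ , T} {_ , T′} ST∈ ST′∈ T≢T′ (v∈ , v∈′)
    with σ , σ∈ , refl ← ∈-map⁻ (λ σ → σ ++ x ∷ reverse T) v∈
    with σ′ , σ′∈ , eq ← ∈-map⁻ (λ σ → σ ++ x ∷ reverse T′) v∈′ =
    T≢T′ (List.reverse-injective (proj₂ (split-injective σ σ′ (x∉earlier ST∈ σ∈) (x∉earlier ST′∈ σ′∈) eq)))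

  straddling-distinct : ∀ {ST ST′} → ST ∈ patternSplits p L → ST′ ∈ patternSplits p L → proj₂ ST ≢ proj₂ ST′ →
                        straddling ST ≢ straddling ST′
  straddling-distinct {S , _} {S′ , _} ST∈ ST′∈ T≢T′ eq =
    T≢T′ (List.reverse-injective (proj₂ (split-injective (reverse S) (reverse S′) (x∉straddling ST∈) (x∉straddling ST′∈) eq)))

  earlier-straddling : Disjoint (concatMap earlier (splits L)) (map straddling (patternSplits p L))
  earlier-straddling (v∈ , v∈′)
    with (S , T) , ST∈ , v∈map ← find (∈-concatMap⁻ earlier {xs = splits L} v∈)
    with σ , σ∈ , refl ← ∈-map⁻ (λ σ → σ ++ x ∷ reverse T) v∈map
    with (S′ , T′) , ST∈′ , eq ← ∈-map⁻ straddling v∈′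
    with refl , _ ← split-injective σ (reverse S′) (x∉earlier ST∈ σ∈) (x∉straddling ST∈′) eq =
    patternSplits-¬Begins p inc ST∈′
      (proj₂ (proj₂ (avoiders-sound f p (proj₁ (AllPairs-interleaving (splits-sound L ST∈) inc)) σ∈)))

-- From vectors to lists

module _ {R : X → X → Set} where

  AllPairs-toList⁺ : ∀ {n} {v : Vec X n} → (∀ {i j} → i Fin.< j → R (lookup v i) (lookup v j)) →
    AllPairs R (toList v)
  AllPairs-toList⁺ {v = []}    r = []
  AllPairs-toList⁺ {v = a ∷ v} r =
    All-toList v (λ i → r {zero} {suc i} (s≤s z≤n)) ∷ AllPairs-toList⁺ (λ i<j → r (s≤s i<j))
    where
    All-toList : ∀ {n} (v : Vec X n) → (∀ i → R a (lookup v i)) → All (R a) (toList v)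
    All-toList []      r = []
    All-toList (b ∷ v) r = r zero ∷ All-toList v (λ i → r (suc i))

  AllPairs-toList⁻ : ∀ {n} (v : Vec X n) → AllPairs R (toList v) → ∀ {i j} → i Fin.< j →
    R (lookup v i) (lookup v j)
  AllPairs-toList⁻ (a ∷ v) (r ∷ rs) {zero}  {suc j} _         = VecAll.lookup⁺ (VecAll.toList⁻ r) j
  AllPairs-toList⁻ (a ∷ v) (r ∷ rs) {suc i} {suc j} (s≤s i<j) = AllPairs-toList⁻ v rs i<j

  Linked-toList⁺ : ∀ {n} (v : Vec X n) →
    (∀ j j⁺ → toℕ j⁺ ≡ suc (toℕ j) → R (lookup v j) (lookup v j⁺)) →
    Linked R (toList v)
  Linked-toList⁺ []          r = []
  Linked-toList⁺ (a ∷ [])    r = [-]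
  Linked-toList⁺ (a ∷ b ∷ v) r =
    r zero (suc zero) refl ∷ Linked-toList⁺ (b ∷ v) (λ j j⁺ eq → r (suc j) (suc j⁺) (≡.cong suc eq))

  Linked-toList⁻ : ∀ {n} (v : Vec X n) → Linked R (toList v) → ∀ j j⁺ → toℕ j⁺ ≡ suc (toℕ j) →
    R (lookup v j) (lookup v j⁺)
  Linked-toList⁻ (a ∷ b ∷ v) (r ∷ rs) zero    (suc zero) refl = r
  Linked-toList⁻ (a ∷ b ∷ v) (r ∷ rs) (suc j) (suc j⁺)   eq   =
    Linked-toList⁻ (b ∷ v) rs j j⁺ (ℕ.suc-injective eq)

Unique-toList⁺ : ∀ {n} {v : Vec X n} → Vec.Unique v → Unique (toList v)
Unique-toList⁺ {v = []}    []       = []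
Unique-toList⁺ {v = a ∷ v} (r ∷ rs) = VecAll.toList⁺ r ∷ Unique-toList⁺ rs

Unique-toList⁻ : ∀ {n} {v : Vec X n} → Unique (toList v) → Vec.Unique v
Unique-toList⁻ {v = []}    []       = []
Unique-toList⁻ {v = a ∷ v} (r ∷ rs) = VecAll.toList⁻ r ∷ Unique-toList⁻ rs

toList-injective : ∀ {n} {u v : Vec X n} → toList u ≡ toList v → u ≡ v
toList-injective {u = u} {v} eq = ≡.trans (≡.sym (Vec.cast-is-id refl u)) (Vec.toList-injective refl u v eq)

toList-surjective : ∀ {n} (w : List X) → length w ≡ n → ∃[ v ] toList {n = n} v ≡ w
toList-surjective w refl = fromList w , Vec.toList∘fromList w

toList-truncate : ∀ {k n} (k≤n : k ≤ n) (v : Vec X n) → ∃[ rest ] toList v ≡ toList (truncate k≤n v) ++ rest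
toList-truncate z≤n       v       = toList v , refl
toList-truncate (s≤s k≤n) (a ∷ v) = map₂ (≡.cong (a ∷_)) (toList-truncate k≤n v)

++-injective : ∀ (xs ys : List X) {xs′ ys′} → length xs ≡ length ys → xs ++ xs′ ≡ ys ++ ys′ → xs ≡ ys × xs′ ≡ ys′
++-injective []       []       _   eq = refl , eq
++-injective (x ∷ xs) (y ∷ ys) len eq with refl , eq′ ← List.∷-injective eq =
  map₁ (≡.cong (x ∷_)) (++-injective xs ys (ℕ.suc-injective len) eq′)

Unique⇒↭-allFin : ∀ {n} (π : Vec (Fin n) n) → Vec.Unique π → toList π ↭ List.allFin n
Unique⇒↭-allFin {n} π uniq = ∼bag⇒↭ (unique∧set⇒bag (Unique-toList⁺ uniq) (Unique.allFin⁺ n)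
  (mk⇔ (λ _ → ∈-allFin _) (λ _ → contains _)))
  where
  contains : ∀ a → a ∈ toList π
  contains a with member? Fin._≟_ a (toList π)
  ... | yes a∈ = a∈
  -- Pigeonhole: putting a missing letter in front of `π` would give an injection from n+1 positions
  -- into n letters.
  ... | no  a∉ = ⊥-elim (ℕ.1+n≰n (Fin.injective⇒≤ {f = lookup (a ∷ π)} λ {i} {j} →
          VecUnique.lookup-injective (Unique-toList⁻ {v = a ∷ π} (All.¬Any⇒All¬ _ a∉ ∷ Unique-toList⁺ uniq)) i j))

allFin-increasing : ∀ n → Increasing (List.allFin n)
allFin-increasing n = AllPairs.tabulate⁺-< λ i<j → i<j

-- The pattern 1-23

123-iso⁺ : ∀ {a b c : Fin N} → a Fin.< b → b Fin.< c → OrderIsomorphic (a ∷ b ∷ c ∷ []) (Vec.allFin 3)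
123-iso⁺ {a = a} {b} {c} a<b b<c = iso
  where
  less : ∀ {m n} {i j : Fin m} {i′ j′ : Fin n} → i Fin.< j → i′ Fin.< j′ → (i Fin.< j) ⇔ (i′ Fin.< j′)
  less p q = mk⇔ (λ _ → q) (λ _ → p)
  notLess : ∀ {m n} {i j : Fin m} {i′ j′ : Fin n} → j Fin.≤ i → j′ Fin.≤ i′ → (i Fin.< j) ⇔ (i′ Fin.< j′)
  notLess p q = mk⇔ (λ r → ⊥-elim (ℕ.≤⇒≯ p r)) (λ r → ⊥-elim (ℕ.≤⇒≯ q r))
  iso : OrderIsomorphic (a ∷ b ∷ c ∷ []) (Vec.allFin 3)
  iso zero             zero             = notLess {i = a} {a} {zero {2}} {zero {2}} ℕ.≤-refl ℕ.≤-refl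
  iso zero             (suc zero)       = less {i = a} {b} {zero {2}} {suc zero} a<b (s≤s z≤n)
  iso zero             (suc (suc zero)) =
    less {i = a} {c} {zero {2}} {suc (suc zero)} (ℕ.<-trans a<b b<c) (s≤s z≤n)
  iso (suc zero)       zero             = notLess {i = b} {a} {suc {2} zero} {zero} (ℕ.<⇒≤ a<b) z≤n
  iso (suc zero)       (suc zero)       = notLess {i = b} {b} {suc {2} zero} {suc zero} ℕ.≤-refl ℕ.≤-refl
  iso (suc zero)       (suc (suc zero)) =
    less {i = b} {c} {suc {2} zero} {suc (suc zero)} b<c (s≤s (s≤s z≤n))
  iso (suc (suc zero)) zero             =
    notLess {i = c} {a} {suc {2} (suc zero)} {zero} (ℕ.<⇒≤ (ℕ.<-trans a<b b<c)) z≤n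
  iso (suc (suc zero)) (suc zero)       =
    notLess {i = c} {b} {suc {2} (suc zero)} {suc zero} (ℕ.<⇒≤ b<c) (s≤s z≤n)
  iso (suc (suc zero)) (suc (suc zero)) =
    notLess {i = c} {c} {suc {2} (suc zero)} {suc (suc zero)} ℕ.≤-refl ℕ.≤-refl

Occurrence : ∀ {n} → Vec (Fin N) n → Set
Occurrence v = ∃[ i ] ∃[ j ] ∃[ j⁺ ] (i Fin.< j × toℕ j⁺ ≡ suc (toℕ j) ×
  lookup v i Fin.< lookup v j × lookup v j Fin.< lookup v j⁺)

Avoids⁺ : ∀ {n} (v : Vec (Fin N) n) → ¬ Occurrence v → Avoids (toList v)
Avoids⁺ []      av = tt
Avoids⁺ (a ∷ v) av =
    Linked-toList⁺ v (λ j j⁺ eq (a<b , b<c) → av (zero , suc j , suc j⁺ , s≤s z≤n , ≡.cong suc eq , a<b , b<c))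
  , Avoids⁺ v (λ (i , j , j⁺ , i<j , eq , p) → av (suc i , suc j , suc j⁺ , s≤s i<j , ≡.cong suc eq , p))

Avoids⁻ : ∀ {n} (v : Vec (Fin N) n) → Avoids (toList v) → ¬ Occurrence v
Avoids⁻ (a ∷ v) (na , av) (zero  , suc j , suc j⁺ , _       , eq , p) =
  Linked-toList⁻ v na j j⁺ (ℕ.suc-injective eq) p
Avoids⁻ (a ∷ v) (na , av) (suc i , suc j , suc j⁺ , s≤s i<j , eq , p) =
  Avoids⁻ v av (i , j , j⁺ , i<j , ℕ.suc-injective eq , p)

Avoids⇔ : ∀ {n} (π : Vec (Fin n) n) → Avoids-1-23 π ⇔ Avoids (toList π)
Avoids⇔ π = mk⇔ (λ av → Avoids⁺ π (av ∘ contains)) (λ av → Avoids⁻ π av ∘ occurrence)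
  where
  contains : Occurrence π → Contains-1-23 π
  contains (i , j , j⁺ , i<j , eq , p , q) = i , j , j⁺ , i<j , eq , 123-iso⁺ p q
  occurrence : Contains-1-23 π → Occurrence π
  occurrence (i , j , j⁺ , i<j , eq , iso) = i , j , j⁺ , i<j , eq
    , Equivalence.from (iso zero (suc zero)) (s≤s z≤n)
    , Equivalence.from (iso (suc zero) (suc (suc zero))) (s≤s (s≤s z≤n))

-- The pattern (k-1)(k-2)⋯1k

lookup-∷ʳ-inject₁ : ∀ {n} (v : Vec X n) x i → lookup (v ∷ʳ x) (inject₁ i) ≡ lookup v i
lookup-∷ʳ-inject₁ (_ ∷ v) x zero    = refl
lookup-∷ʳ-inject₁ (_ ∷ v) x (suc i) = lookup-∷ʳ-inject₁ v x i

lookup-∷ʳ-fromℕ : ∀ {n} (v : Vec X n) x → lookup (v ∷ʳ x) (fromℕ n) ≡ x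
lookup-∷ʳ-fromℕ []      x = refl
lookup-∷ʳ-fromℕ (_ ∷ v) x = lookup-∷ʳ-fromℕ v x

inject₁<fromℕ : ∀ {n} (i : Fin n) → inject₁ i Fin.< fromℕ n
inject₁<fromℕ {n} i = ≡.subst₂ ℕ._<_ (≡.sym (Fin.toℕ-inject₁ i)) (≡.sym (Fin.toℕ-fromℕ n)) (Fin.toℕ<n i)

decreasing-iso : ∀ {M N n} (u : Vec (Fin M) n) (v : Vec (Fin N) n) →
  Decreasing (toList u) → Decreasing (toList v) → OrderIsomorphic u v
decreasing-iso u v decu decv i j with Fin.<-cmp i j
... | tri< i<j _ _ = mk⇔
  (λ p → ⊥-elim (ℕ.<-asym p (AllPairs-toList⁻ u decu i<j)))
  (λ p → ⊥-elim (ℕ.<-asym p (AllPairs-toList⁻ v decv i<j)))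
... | tri≈ _ refl _ = mk⇔ (λ p → ⊥-elim (ℕ.<-irrefl refl p)) (λ p → ⊥-elim (ℕ.<-irrefl refl p))
... | tri> _ _ j<i = mk⇔ (λ _ → AllPairs-toList⁻ v decv j<i) (λ _ → AllPairs-toList⁻ u decu j<i)

module _ {M N n} (u : Vec (Fin M) n) (v : Vec (Fin N) n) (a : Fin M) (b : Fin N) where

  ∷ʳ-iso⁺ : OrderIsomorphic u v → All (Fin._< a) (toList u) → All (Fin._< b) (toList v) →
            OrderIsomorphic (u ∷ʳ a) (v ∷ʳ b)
  ∷ʳ-iso⁺ iso u<a v<b i j with Top.view i | Top.view j
  ... | ‵inject₁ i | ‵inject₁ j
    rewrite lookup-∷ʳ-inject₁ u a i | lookup-∷ʳ-inject₁ v b i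
          | lookup-∷ʳ-inject₁ u a j | lookup-∷ʳ-inject₁ v b j = iso i j
  ... | ‵inject₁ i | ‵fromℕ
    rewrite lookup-∷ʳ-inject₁ u a i | lookup-∷ʳ-inject₁ v b i
          | lookup-∷ʳ-fromℕ u a | lookup-∷ʳ-fromℕ v b =
    mk⇔ (λ _ → VecAll.lookup⁺ (VecAll.toList⁻ v<b) i) (λ _ → VecAll.lookup⁺ (VecAll.toList⁻ u<a) i)
  ... | ‵fromℕ | ‵inject₁ j
    rewrite lookup-∷ʳ-inject₁ u a j | lookup-∷ʳ-inject₁ v b j
          | lookup-∷ʳ-fromℕ u a | lookup-∷ʳ-fromℕ v b =
    mk⇔ (λ p → ⊥-elim (ℕ.<-asym p (VecAll.lookup⁺ (VecAll.toList⁻ u<a) j)))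
        (λ p → ⊥-elim (ℕ.<-asym p (VecAll.lookup⁺ (VecAll.toList⁻ v<b) j)))
  ... | ‵fromℕ | ‵fromℕ
    rewrite lookup-∷ʳ-fromℕ u a | lookup-∷ʳ-fromℕ v b =
    mk⇔ (λ p → ⊥-elim (ℕ.<-irrefl refl p)) (λ p → ⊥-elim (ℕ.<-irrefl refl p))

  ∷ʳ-iso⁻ : OrderIsomorphic (u ∷ʳ a) (v ∷ʳ b) → Decreasing (toList v) → All (Fin._< b) (toList v) →
            Decreasing (toList u) × All (Fin._< a) (toList u)
  ∷ʳ-iso⁻ iso decv v<b =
      AllPairs-toList⁺ {v = u} (λ {i} {j} i<j →
        ≡.subst₂ Fin._<_ (lookup-∷ʳ-inject₁ u a j) (lookup-∷ʳ-inject₁ u a i)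
          (Equivalence.from (iso (inject₁ j) (inject₁ i))
            (≡.subst₂ Fin._<_ (≡.sym (lookup-∷ʳ-inject₁ v b j)) (≡.sym (lookup-∷ʳ-inject₁ v b i))
              (AllPairs-toList⁻ v decv i<j))))
    , VecAll.toList⁺ (VecAll.lookup⁻ λ i →
        ≡.subst₂ Fin._<_ (lookup-∷ʳ-inject₁ u a i) (lookup-∷ʳ-fromℕ u a)
          (Equivalence.from (iso (inject₁ i) (fromℕ n))
            (≡.subst₂ Fin._<_ (≡.sym (lookup-∷ʳ-inject₁ v b i)) (≡.sym (lookup-∷ʳ-fromℕ v b))
              (VecAll.lookup⁺ (VecAll.toList⁻ v<b) i))))

-- The pattern without its top letter: `startPattern (suc p)` is `descent p ∷ʳ fromℕ p` by
-- computation.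
descent : ∀ p → Vec (Fin (suc p)) p
descent p = Vec.map inject₁ (Vec.reverse (Vec.allFin p))

descent-decreasing : ∀ p → Decreasing (toList (descent p))
descent-decreasing p = ≡.subst Decreasing
  (≡.sym (≡.trans (Vec.toList-map inject₁ (Vec.reverse (Vec.allFin p)))
                  (≡.cong (map inject₁) (Vec.toList-reverse (Vec.allFin p)))))
  (AllPairs.map⁺ (AllPairs.map inject₁-mono (AllPairs-reverse increasing)))
  where
  inject₁-mono : ∀ {i j : Fin p} → j Fin.< i → inject₁ j Fin.< inject₁ i
  inject₁-mono {i} {j} = ≡.subst₂ ℕ._<_ (≡.sym (Fin.toℕ-inject₁ j)) (≡.sym (Fin.toℕ-inject₁ i))
  increasing : Increasing (toList (Vec.allFin p))
  increasing = AllPairs-toList⁺ {v = Vec.allFin p} λ {i} {j} →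
    ≡.subst₂ (Fin._<_ {p} {p}) (≡.sym (Vec.lookup-allFin i)) (≡.sym (Vec.lookup-allFin j))

descent<fromℕ : ∀ p → All (Fin._< fromℕ p) (toList (descent p))
descent<fromℕ p =
  ≡.subst (All (Fin._< fromℕ p)) (≡.sym (Vec.toList-map inject₁ (Vec.reverse (Vec.allFin p))))
  (All.map⁺ (All.universal inject₁<fromℕ _))

Begins⁺ : ∀ p {n} (π : Vec (Fin n) n) → BeginsWith (startPattern (suc p)) π → Begins p (toList π)
Begins⁺ zero    π _                  = tt
Begins⁺ (suc m) π (inj₁ (k≤n , iso)) with initLast (truncate k≤n π) | toList-truncate k≤n π
... | u , a , eq | rest , eq′ rewrite eq =
  let dec , u<a =
        ∷ʳ-iso⁻ u (descent (suc m)) a (fromℕ (suc m)) iso (descent-decreasing (suc m)) (descent<fromℕ (suc m))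
  in toList u , a , rest
   , ≡.trans eq′ (≡.trans (≡.cong (_++ rest) (Vec.toList-∷ʳ a u)) (List.++-assoc (toList u) [ a ] rest))
   , Vec.length-toList u , dec , u<a

Begins⁻ : ∀ p {n} (π : Vec (Fin n) n) → Begins p (toList π) → BeginsWith (startPattern (suc p)) π
Begins⁻ zero {zero}  π _ = inj₂ (refl , refl)
Begins⁻ zero {suc n} (a ∷ _) _ = inj₁ (s≤s z≤n , ∷ʳ-iso⁺ [] [] a zero (λ ()) [] [])
Begins⁻ (suc m) {n} π be@(d , e , rest , eq , len , dec , d<e) = inj₁ (k≤n , iso)
  where
  k≤n : suc (suc m) ≤ n
  k≤n = ≡.subst (suc (suc m) ≤_) (Vec.length-toList π) (Begins⇒length> m be)
  iso : OrderIsomorphic (truncate k≤n π) (startPattern (suc (suc m)))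
  iso with initLast (truncate k≤n π) | toList-truncate k≤n π
  ... | u , a , eq₁ | rest′ , eq₂ rewrite eq₁
    with toListu≡d , refl ← ++-injective (toList u) d (≡.trans (Vec.length-toList u) (≡.sym len))
           (≡.trans (≡.sym (≡.trans eq₂ (≡.trans (≡.cong (_++ rest′) (Vec.toList-∷ʳ a u)) (List.++-assoc (toList u) [ a ] rest′)))) eq) =
    ∷ʳ-iso⁺ u (descent (suc m)) a (fromℕ (suc m))
      (decreasing-iso u (descent (suc m)) (≡.subst Decreasing (≡.sym toListu≡d) dec) (descent-decreasing (suc m)))
      (≡.subst (All (Fin._< a)) (≡.sym toListu≡d) d<e) (descent<fromℕ (suc m))

-- The count of permutations and the generating function identity

words-unique : ∀ m n → Unique (words m n)
words-unique m zero    = [] ∷ []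
words-unique m (suc n) =
  Unique.cartesianProductWith⁺ _∷_ Vec.∷-injective (Unique.allFin⁺ m) (words-unique m n)

words-complete : ∀ {m n} (v : Vec (Fin m) n) → v ∈ words m n
words-complete []      = here refl
words-complete (a ∷ v) = ∈-cartesianProductWith⁺ _∷_ (∈-allFin a) (words-complete v)

-- The filtered words, read as lists, and the enumeration are both free of repetitions and have the
-- same members, so one is a rearrangement of the other.
N-1-23≡avoiderCount : ∀ p n → N-1-23 (startPattern (suc p)) n ≡ avoiderCount n p n
N-1-23≡avoiderCount p n = begin
  length counted                                ≡⟨ List.length-map toList counted ⟨
  length (map toList counted)                   ≡⟨ ↭-length (∼bag⇒↭ (unique∧set⇒bag
                                                    (Unique.map⁺ toList-injective (Unique.filter⁺ counts? (words-unique n n)))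
                                                    (avoiders-unique n p (allFin-increasing n))
                                                    (mk⇔ to from))) ⟩
  length (avoiders n p (List.allFin n))         ≡⟨ length-avoiders n p (List.allFin n) ⟩
  avoiderCount n p (length (List.allFin n))
    ≡⟨ ≡.cong (avoiderCount n p) (List.length-tabulate {n = n} λ i → i) ⟩
  avoiderCount n p n                            ∎
  where
  open ≡.≡-Reasoning
  counts? =
    λ (π : Vec (Fin n) n) → unique? π ×-dec avoids-1-23? π ×-dec beginsWith? (startPattern (suc p)) π
  counted = filter counts? (words n n)
  to : ∀ {w} → w ∈ map toList counted → w ∈ avoiders n p (List.allFin n)
  to w∈ with π , π∈ , refl ← ∈-map⁻ toList w∈
        with _ , uniq , av , be ← ∈-filter⁻ counts? {xs = words n n} π∈ =
    avoiders-complete n p (allFin-increasing n) (ℕ.≤-reflexive (List.length-tabulate λ i → i))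
      (Unique⇒↭-allFin π uniq , Equivalence.to (Avoids⇔ π) av , Begins⁺ p π be)
  from : ∀ {w} → w ∈ avoiders n p (List.allFin n) → w ∈ map toList counted
  from {w} w∈ with w↭ , av , be ← avoiders-sound n p (allFin-increasing n) w∈
              with π , refl ← toList-surjective w (≡.trans (↭-length w↭) (List.length-tabulate {n = n} λ i → i)) =
    ∈-map⁺ toList (∈-filter⁺ counts? (words-complete π)
      ( Unique-toList⁻ (Unique-resp-↭ (↭-sym w↭) (Unique.allFin⁺ n))
      , Equivalence.from (Avoids⇔ π) av , Begins⁻ p π be))

N-1-23-suc : ∀ p n → N-1-23 (startPattern (suc p)) (suc n) ≡
             binomialTransform (N-1-23 (startPattern (suc p))) n ℕ.+ patternCount p n
N-1-23-suc p n = ≡.trans (N-1-23≡avoiderCount p (suc n)) (≡.trans (avoiderCount-suc p n)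
  (≡.cong (ℕ._+ patternCount p n) (binomialTransform-cong n λ i _ → ≡.sym (N-1-23≡avoiderCount p i))))

proposition23 :
  ∀ {c ℓ} (A : ExpAlgebra c ℓ) →
  let K = ExpAlgebra.rawExpAlgebra A
      open RawExpAlgebra (powerSeries K)
      open Bivariate K
      x = var K
  in
  ∀ (k : ℕ) .{{_ : NonZero k}} →
    (2 ≤ k → egf K (N-1-23 (startPattern k)) ≈ exp (exp x) * ∫₀ K (∫₀ᵗ integrand (k ∸ 2) dr)) ×
    (k ≡ 1 → egf K (N-1-23 (startPattern k)) ≈ exp (exp x - 1#))
proposition23 A (suc zero)    = (λ { (s≤s ()) }) , λ _ →
  ClosedForms.egf≋exp A (N-1-23 (startPattern 1)) (N-1-23≡avoiderCount 0 0)
    λ n → ≡.trans (N-1-23-suc 0 n) (ℕ.+-identityʳ _)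
proposition23 A (suc (suc m)) = (λ _ →
  ClosedForms.egf≋∫ A m (N-1-23 (startPattern (suc (suc m)))) (N-1-23≡avoiderCount (suc m) 0)
    -- Here k = m + 2, so p = m + 1, and `patternCount (suc m)` is `delayedChoose m` by computation.
    (N-1-23-suc (suc m))) , λ ()
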